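{- For each of the calculi $\mathcal{F}_{2018}$, $\mathcal{F}^{ - }_{2018}$, $\mathcal{M}'_{2018}$, $\mathcal{M}'^{ - }_{2018}$ and $\mathcal{M}_{2018}$, the derivability problem restricted to its one-division fragment is algorithmically undecidable; here the one-division fragment consists of the sequents all of whose formulae are built from variables using only $/$, $!$, $\langle\rangle$ and $[]^{ -1}$, possibly with brackets in the antecedent.
   Context: Formulae are built from a countable set of variables and $\mathbf1$ by $\backslash,/,\cdot,\wedge,\vee$ and the unary $\langle\rangle$, $[]^{ -1}$, $!$. Calculi with stoups: a stoup is a finite multiset of formulae ($\varnothing$ empty); a tree term is a formula or $[\Xi]$; a meta-formula is $\zeta;\Gamma$ ($\zeta$ a stoup, $\Gamma$ a finite sequence of tree terms, empty $\Lambda$), $\varnothing;\Gamma$ written $\Gamma$; comma is concatenation / multiset union; sequents $\Xi\to C$; $\Xi(\Theta)$ designates an occurrence of a meta-formula $\Theta$ which is $\Xi$ itself or the content of a bracket $[\Theta]$ at any depth. Common rules: axioms $A\to A$, $\Lambda\to\mathbf1$; ($/L$) from $\zeta_1;\Gamma\to B$ and $\Xi(\zeta_2;\Delta_1,C,\Delta_2)\to D$ infer $\Xi(\zeta_1,\zeta_2;\Delta_1,C/B,\Gamma,\Delta_2)\to D$; ($/R$) from $\zeta;\Gamma,B\to C$ infer $\zeta;\Gamma\to C/B$; ($\backslash L$) from $\zeta_1;\Gamma\to A$ and $\Xi(\zeta_2;\Delta_1,C,\Delta_2)\to D$ infer $\Xi(\zeta_1,\zeta_2;\Delta_1,\Gamma,A\backslash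 C,\Delta_2)\to D$; ($\backslash R$) from $\zeta;A,\Gamma\to C$ infer $\zeta;\Gamma\to A\backslash C$; ($\cdot L$) from $\Xi(\zeta;\Delta_1,A,B,\Delta_2)\to D$ infer $\Xi(\zeta;\Delta_1,A\cdot B,\Delta_2)\to D$; ($\cdot R$) from $\zeta_1;\Delta\to A$, $\zeta_2;\Gamma\to B$ infer $\zeta_1,\zeta_2;\Delta,\Gamma\to A\cdot B$; ($\mathbf1L$) from $\Xi(\zeta;\Delta_1,\Delta_2)\to A$ infer $\Xi(\zeta;\Delta_1,\mathbf1,\Delta_2)\to A$; additive rules with context $\Xi(\zeta;\Delta_1,\cdot,\Delta_2)$ on the left and arbitrary $\Xi$ on the right; ($[]^{ -1}L$) from $\Xi(\zeta;\Delta_1,A,\Delta_2)\to B$ infer $\Xi(\zeta;\Delta_1,[[]^{ -1}A],\Delta_2)\to B$; ($[]^{ -1}R$) from $[\Xi]\to A$ infer $\Xi\to[]^{ -1}A$; ($\langle\rangle L$) from $\Xi(\zeta;\Delta_1,[A],\Delta_2)\to B$ infer $\Xi(\zeta;\Delta_1,\langle\rangle A,\Delta_2)\to B$; ($\langle\rangle R$) from $\Xi\to A$ infer $[\Xi]\to\langle\rangle A$; ($!L$) from $\Xi(\zeta,A;\Gamma_1,\Gamma_2)\to B$ infer $\Xi(\zeta;\Gamma_1,!A,\Gamma_2)\to B$; ($!P$) from $\Xi(\zeta;\Gamma_1,A,\Gamma_2)\to B$ infer $\Xi(\zeta,A;\Gamma_1,\Gamma_2)\to B$. $\mathcal{M}_{2018}$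 adds ($!R$) from $!A\to B$ infer $!A\to!B$ and ($!C$) from $\Xi(\zeta,A;\Gamma_1,[A;\Gamma_2],\Gamma_3)\to B$ infer $\Xi(\zeta,A;\Gamma_1,[[\Gamma_2]],\Gamma_3)\to B$. $\mathcal{M}'_{2018}$ adds ($!R'$) from $A;\Lambda\to B$ infer $A;\Lambda\to!B$ and ($!C'$) from $\Xi(\zeta,A;\Gamma_1,[\zeta',A;\Gamma_2],\Gamma_3)\to B$ infer $\Xi(\zeta,A;\Gamma_1,[[\zeta';\Gamma_2]],\Gamma_3)\to B$. $\mathcal{M}'^{ - }_{2018}$ is $\mathcal{M}'_{2018}$ restricted to formulae without $\mathbf1$, without $\Lambda\to\mathbf1$ and $\mathbf1L$, with $\backslash R,/R$ only if $\Gamma\ne\Lambda$ or $\zeta\ne\varnothing$ and $!C'$ only if $\Gamma_2\ne\Lambda$ or $\zeta'\neq\varnothing$. Cut is not a rule of these. Stoup-free calculi: meta-formulae are finite sequences of tree terms; rules are the stoup-free versions of the common rules (drop all stoups), except $!L$ is: from $\Xi(\Delta_1,A,\Delta_2)\to C$ infer $\Xi(\Delta_1,!A,\Delta_2)\to C$; plus ($!P_1$) from $\Xi(\Delta_1,!A,\Phi,\Delta_2)\to C$ infer $\Xi(\Delta_1,\Phi,!A,\Delta_2)\to C$, ($!P_2$) the converse, and (cut) from $\Pi\to A$ and $\Xi(\Gamma_1,A,\Gamma_2)\to C$ infer $\Xi(\Gamma_1,\Pi,\Gamma_2)\to C$. $\mathcal{F}_{2018}$ adds ($!R$) from $!A\to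 B$ infer $!A\to!B$ and ($!C$) from $\Xi(!A,\Gamma_1,[!A,\Gamma_2],\Gamma_3)\to C$ infer $\Xi(!A,\Gamma_1,[[\Gamma_2]],\Gamma_3)\to C$. $\mathcal{F}^{ - }_{2018}$ is $\mathcal{F}_{2018}$ restricted to formulae without $\mathbf1$, without $\Lambda\to\mathbf1$ and $\mathbf1L$, with $\backslash R,/R$ only if $\Gamma\neq\Lambda$, and $!C$ only if $\Gamma_2\ne\Lambda$. -}

module Defs where

open import Data.Bool using (Bool; true; false)
open import Data.Empty using (⊥)
open import Data.Fin using (Fin)
open import Data.List using (List; []; _∷_; _++_; [_]; map; foldr; replicate)
open import Data.List.Properties using (foldr-++)
open import Data.List.Relation.Binary.Permutation.Propositional using (_↭_)
open import Data.List.Relation.Unary.All using (All)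
open import Data.Nat using (ℕ; zero; suc)
open import Data.Product using (_×_; _,_; ∃)
open import Data.Sum using (_⊎_)
open import Data.Unit using (⊤)
open import Function.Definitions using (Injective)
open import Relation.Binary.PropositionalEquality
  using (_≡_; _≢_; refl; sym; trans; cong)
open import Relation.Nullary using (¬_)

-- 'lambek' marks the calculi with superscript "−": no unit, and Lambek's
-- non-emptiness restriction on some rules.

data Restriction : Set where
  none lambek : Restriction

HasUnit : Restriction → Set
HasUnit none   = ⊤
HasUnit lambek = ⊥

Side : Restriction → Set → Set
Side none   P = ⊤
Side lambek P = P

infixr 8 _⧵_
infixl 8 _/_
infixl 9 _·_
infixl 7 _∧_ _∨_
infix 10 ⟨⟩_ []⁻¹_ !_

data Formula (r : Restriction) : Set where
  var         : ℕ → Formula r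
  𝟏           : {u : HasUnit r} → Formula r
  _⧵_ _/_ _·_ : Formula r → Formula r → Formula r
  _∧_ _∨_     : Formula r → Formula r → Formula r
  ⟨⟩_ []⁻¹_   : Formula r → Formula r
  !_          : Formula r → Formula r

data OneDivision {r} : Formula r → Set where
  var   : ∀ n → OneDivision (var n)
  _/_   : ∀ {A B} → OneDivision A → OneDivision B → OneDivision (A / B)
  ⟨⟩_   : ∀ {A} → OneDivision A → OneDivision (⟨⟩ A)
  []⁻¹_ : ∀ {A} → OneDivision A → OneDivision ([]⁻¹ A)
  !_    : ∀ {A} → OneDivision A → OneDivision (! A)

-- Words encoding sequents: prefix notation, the variable with index n being
-- n ticks followed by 'v'.

data Symbol : Set where
  tick v one under over times and or dia box bang : Symbol
  open′ semicolon close arrow                     : Symbol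

encodeFormula : ∀ {r} → Formula r → List Symbol
encodeFormula (var n)  = replicate n tick ++ [ v ]
encodeFormula 𝟏        = [ one ]
encodeFormula (A ⧵ B)  = under ∷ encodeFormula A ++ encodeFormula B
encodeFormula (A / B)  = over  ∷ encodeFormula A ++ encodeFormula B
encodeFormula (A · B)  = times ∷ encodeFormula A ++ encodeFormula B
encodeFormula (A ∧ B)  = and   ∷ encodeFormula A ++ encodeFormula B
encodeFormula (A ∨ B)  = or    ∷ encodeFormula A ++ encodeFormula B
encodeFormula (⟨⟩ A)   = dia   ∷ encodeFormula A
encodeFormula ([]⁻¹ A) = box   ∷ encodeFormula A
encodeFormula (! A)    = bang  ∷ encodeFormula A

module Stoup (r : Restriction) where

  infix 4 _⨾_
  infix 3 _⇒_

  -- Multisets are represented by lists; the rule 'exchange' below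
  -- identifies lists that are permutations of each other.
  Stoup : Set
  Stoup = List (Formula r)

  ∅ : Stoup
  ∅ = []

  mutual
    data Tree : Set where
      fm  : Formula r → Tree
      ⟦_⟧ : Meta → Tree

    data Meta : Set where
      _⨾_ : Stoup → List Tree → Meta

  Λ : List Tree
  Λ = []

  -- Ξ ⟨ Θ ⟩ is the paper's Ξ(Θ).
  data Context : Set where
    ∙       : Context
    _⨾_⟦_⟧_ : Stoup → List Tree → Context → List Tree → Context

  _⟨_⟩ : Context → Meta → Meta
  ∙               ⟨ Θ ⟩ = Θ
  (ζ ⨾ Γ ⟦ Ξ ⟧ Δ) ⟨ Θ ⟩ = ζ ⨾ Γ ++ ⟦ Ξ ⟨ Θ ⟩ ⟧ ∷ Δ

  record Sequent : Set where
    constructor _⇒_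
    field
      antecedent : Meta
      succedent  : Formula r

  variable
    A B C D       : Formula r
    ζ ζ′ ζ₁ ζ₂    : Stoup
    Γ Γ₁ Γ₂ Γ₃    : List Tree
    Δ Δ₁ Δ₂       : List Tree
    Θ             : Meta
    S S′          : Sequent

  -- Relations between the premise (first) and the conclusion of a rule.

  data Rule₂₀₁₈ : Sequent → Sequent → Set where
    !R : Rule₂₀₁₈ (∅ ⨾ [ fm (! A) ] ⇒ B)
                  (∅ ⨾ [ fm (! A) ] ⇒ ! B)
    !C : ∀ Ξ →
         Rule₂₀₁₈ (Ξ ⟨ A ∷ ζ ⨾ Γ₁ ++ ⟦ [ A ] ⨾ Γ₂ ⟧ ∷ Γ₃ ⟩ ⇒ B)
                  (Ξ ⟨ A ∷ ζ ⨾ Γ₁ ++ ⟦ ∅ ⨾ [ ⟦ ∅ ⨾ Γ₂ ⟧ ] ⟧ ∷ Γ₃ ⟩ ⇒ B)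

  data Rule′₂₀₁₈ : Sequent → Sequent → Set where
    !R′ : Rule′₂₀₁₈ ([ A ] ⨾ Λ ⇒ B)
                    ([ A ] ⨾ Λ ⇒ ! B)
    !C′ : ∀ Ξ → Side r (Γ₂ ≢ Λ ⊎ ζ′ ≢ ∅) →
          Rule′₂₀₁₈ (Ξ ⟨ A ∷ ζ ⨾ Γ₁ ++ ⟦ A ∷ ζ′ ⨾ Γ₂ ⟧ ∷ Γ₃ ⟩ ⇒ B)
                    (Ξ ⟨ A ∷ ζ ⨾ Γ₁ ++ ⟦ ∅ ⨾ [ ⟦ ζ′ ⨾ Γ₂ ⟧ ] ⟧ ∷ Γ₃ ⟩ ⇒ B)

  module Calculus (Rule : Sequent → Sequent → Set) where

    infix 2 ⊢_

    data ⊢_ : Sequent → Set where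
      exchange : ∀ Ξ → ζ ↭ ζ′ →
                 ⊢ Ξ ⟨ ζ ⨾ Γ ⟩ ⇒ B →
                 ⊢ Ξ ⟨ ζ′ ⨾ Γ ⟩ ⇒ B

      ax  : ⊢ ∅ ⨾ [ fm A ] ⇒ A

      𝟏R  : {u : HasUnit r} → ⊢ ∅ ⨾ Λ ⇒ 𝟏 {u = u}
      𝟏L  : ∀ Ξ {u : HasUnit r} →
            ⊢ Ξ ⟨ ζ ⨾ Δ₁ ++ Δ₂ ⟩ ⇒ A →
            ⊢ Ξ ⟨ ζ ⨾ Δ₁ ++ fm (𝟏 {u = u}) ∷ Δ₂ ⟩ ⇒ A

      /L  : ∀ Ξ →
            ⊢ ζ₁ ⨾ Γ ⇒ B →
            ⊢ Ξ ⟨ ζ₂ ⨾ Δ₁ ++ fm C ∷ Δ₂ ⟩ ⇒ D →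
            ⊢ Ξ ⟨ ζ₁ ++ ζ₂ ⨾ Δ₁ ++ fm (C / B) ∷ Γ ++ Δ₂ ⟩ ⇒ D
      /R  : Side r (Γ ≢ Λ ⊎ ζ ≢ ∅) →
            ⊢ ζ ⨾ Γ ++ [ fm B ] ⇒ C →
            ⊢ ζ ⨾ Γ ⇒ C / B
      ⧵L  : ∀ Ξ →
            ⊢ ζ₁ ⨾ Γ ⇒ A →
            ⊢ Ξ ⟨ ζ₂ ⨾ Δ₁ ++ fm C ∷ Δ₂ ⟩ ⇒ D →
            ⊢ Ξ ⟨ ζ₁ ++ ζ₂ ⨾ Δ₁ ++ Γ ++ fm (A ⧵ C) ∷ Δ₂ ⟩ ⇒ D
      ⧵R  : Side r (Γ ≢ Λ ⊎ ζ ≢ ∅) →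
            ⊢ ζ ⨾ fm A ∷ Γ ⇒ C →
            ⊢ ζ ⨾ Γ ⇒ A ⧵ C

      ·L  : ∀ Ξ →
            ⊢ Ξ ⟨ ζ ⨾ Δ₁ ++ fm A ∷ fm B ∷ Δ₂ ⟩ ⇒ D →
            ⊢ Ξ ⟨ ζ ⨾ Δ₁ ++ fm (A · B) ∷ Δ₂ ⟩ ⇒ D
      ·R  : ⊢ ζ₁ ⨾ Δ ⇒ A →
            ⊢ ζ₂ ⨾ Γ ⇒ B →
            ⊢ ζ₁ ++ ζ₂ ⨾ Δ ++ Γ ⇒ A · B

      ∧L₁ : ∀ Ξ →
            ⊢ Ξ ⟨ ζ ⨾ Δ₁ ++ fm A ∷ Δ₂ ⟩ ⇒ D →
            ⊢ Ξ ⟨ ζ ⨾ Δ₁ ++ fm (A ∧ B) ∷ Δ₂ ⟩ ⇒ D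
      ∧L₂ : ∀ Ξ →
            ⊢ Ξ ⟨ ζ ⨾ Δ₁ ++ fm B ∷ Δ₂ ⟩ ⇒ D →
            ⊢ Ξ ⟨ ζ ⨾ Δ₁ ++ fm (A ∧ B) ∷ Δ₂ ⟩ ⇒ D
      ∧R  : ⊢ Θ ⇒ A →
            ⊢ Θ ⇒ B →
            ⊢ Θ ⇒ A ∧ B
      ∨L  : ∀ Ξ →
            ⊢ Ξ ⟨ ζ ⨾ Δ₁ ++ fm A ∷ Δ₂ ⟩ ⇒ D →
            ⊢ Ξ ⟨ ζ ⨾ Δ₁ ++ fm B ∷ Δ₂ ⟩ ⇒ D →
            ⊢ Ξ ⟨ ζ ⨾ Δ₁ ++ fm (A ∨ B) ∷ Δ₂ ⟩ ⇒ D
      ∨R₁ : ⊢ Θ ⇒ A →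
            ⊢ Θ ⇒ A ∨ B
      ∨R₂ : ⊢ Θ ⇒ B →
            ⊢ Θ ⇒ A ∨ B

      []⁻¹L : ∀ Ξ →
              ⊢ Ξ ⟨ ζ ⨾ Δ₁ ++ fm A ∷ Δ₂ ⟩ ⇒ B →
              ⊢ Ξ ⟨ ζ ⨾ Δ₁ ++ ⟦ ∅ ⨾ [ fm ([]⁻¹ A) ] ⟧ ∷ Δ₂ ⟩ ⇒ B
      []⁻¹R : ⊢ ∅ ⨾ [ ⟦ Θ ⟧ ] ⇒ A →
              ⊢ Θ ⇒ []⁻¹ A
      ⟨⟩L   : ∀ Ξ →
              ⊢ Ξ ⟨ ζ ⨾ Δ₁ ++ ⟦ ∅ ⨾ [ fm A ] ⟧ ∷ Δ₂ ⟩ ⇒ B →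
              ⊢ Ξ ⟨ ζ ⨾ Δ₁ ++ fm (⟨⟩ A) ∷ Δ₂ ⟩ ⇒ B
      ⟨⟩R   : ⊢ Θ ⇒ A →
              ⊢ ∅ ⨾ [ ⟦ Θ ⟧ ] ⇒ ⟨⟩ A

      !L  : ∀ Ξ →
            ⊢ Ξ ⟨ A ∷ ζ ⨾ Γ₁ ++ Γ₂ ⟩ ⇒ B →
            ⊢ Ξ ⟨ ζ ⨾ Γ₁ ++ fm (! A) ∷ Γ₂ ⟩ ⇒ B
      !P  : ∀ Ξ →
            ⊢ Ξ ⟨ ζ ⨾ Γ₁ ++ fm A ∷ Γ₂ ⟩ ⇒ B →
            ⊢ Ξ ⟨ A ∷ ζ ⨾ Γ₁ ++ Γ₂ ⟩ ⇒ B

      rule : Rule S S′ → ⊢ S → ⊢ S′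

  mutual
    data OneDivisionTree : Tree → Set where
      fm  : OneDivision A → OneDivisionTree (fm A)
      ⟦_⟧ : OneDivisionMeta Θ → OneDivisionTree ⟦ Θ ⟧

    data OneDivisionMeta : Meta → Set where
      _⨾_ : All OneDivision ζ → All OneDivisionTree Γ → OneDivisionMeta (ζ ⨾ Γ)

  OneDivisionSequent : Sequent → Set
  OneDivisionSequent (Θ ⇒ C) = OneDivisionMeta Θ × OneDivision C

  encodeStoup : Stoup → List Symbol
  encodeStoup []      = []
  encodeStoup (A ∷ ζ) = encodeFormula A ++ encodeStoup ζ

  mutual
    encodeTree : Tree → List Symbol
    encodeTree (fm A) = encodeFormula A
    encodeTree ⟦ Θ ⟧  = open′ ∷ encodeMeta Θ ++ [ close ]

    encodeTrees : List Tree → List Symbol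
    encodeTrees []      = []
    encodeTrees (T ∷ Γ) = encodeTree T ++ encodeTrees Γ

    encodeMeta : Meta → List Symbol
    encodeMeta (ζ ⨾ Γ) = encodeStoup ζ ++ semicolon ∷ encodeTrees Γ

  encode : Sequent → List Symbol
  encode (Θ ⇒ C) = encodeMeta Θ ++ arrow ∷ encodeFormula C

module StoupFree (r : Restriction) where

  infix 3 _⇒_
  infix 2 ⊢_

  data Tree : Set where
    fm  : Formula r → Tree
    ⟦_⟧ : List Tree → Tree

  Meta : Set
  Meta = List Tree

  Λ : Meta
  Λ = []

  data Context : Set where
    ∙     : Context
    _⟦_⟧_ : Meta → Context → Meta → Context

  _⟨_⟩ : Context → Meta → Meta
  ∙           ⟨ Θ ⟩ = Θ
  (Γ ⟦ Ξ ⟧ Δ) ⟨ Θ ⟩ = Γ ++ ⟦ Ξ ⟨ Θ ⟩ ⟧ ∷ Δ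

  record Sequent : Set where
    constructor _⇒_
    field
      antecedent : Meta
      succedent  : Formula r

  variable
    A B C D           : Formula r
    Γ Γ₁ Γ₂ Γ₃ Φ Θ Π  : Meta
    Δ Δ₁ Δ₂           : Meta

  data ⊢_ : Sequent → Set where
    ax  : ⊢ [ fm A ] ⇒ A

    𝟏R  : {u : HasUnit r} → ⊢ Λ ⇒ 𝟏 {u = u}
    𝟏L  : ∀ Ξ {u : HasUnit r} →
          ⊢ Ξ ⟨ Δ₁ ++ Δ₂ ⟩ ⇒ A →
          ⊢ Ξ ⟨ Δ₁ ++ fm (𝟏 {u = u}) ∷ Δ₂ ⟩ ⇒ A

    /L  : ∀ Ξ →
          ⊢ Γ ⇒ B →
          ⊢ Ξ ⟨ Δ₁ ++ fm C ∷ Δ₂ ⟩ ⇒ D →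
          ⊢ Ξ ⟨ Δ₁ ++ fm (C / B) ∷ Γ ++ Δ₂ ⟩ ⇒ D
    /R  : Side r (Γ ≢ Λ) →
          ⊢ Γ ++ [ fm B ] ⇒ C →
          ⊢ Γ ⇒ C / B
    ⧵L  : ∀ Ξ →
          ⊢ Γ ⇒ A →
          ⊢ Ξ ⟨ Δ₁ ++ fm C ∷ Δ₂ ⟩ ⇒ D →
          ⊢ Ξ ⟨ Δ₁ ++ Γ ++ fm (A ⧵ C) ∷ Δ₂ ⟩ ⇒ D
    ⧵R  : Side r (Γ ≢ Λ) →
          ⊢ fm A ∷ Γ ⇒ C →
          ⊢ Γ ⇒ A ⧵ C

    ·L  : ∀ Ξ →
          ⊢ Ξ ⟨ Δ₁ ++ fm A ∷ fm B ∷ Δ₂ ⟩ ⇒ D →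
          ⊢ Ξ ⟨ Δ₁ ++ fm (A · B) ∷ Δ₂ ⟩ ⇒ D
    ·R  : ⊢ Δ ⇒ A →
          ⊢ Γ ⇒ B →
          ⊢ Δ ++ Γ ⇒ A · B

    ∧L₁ : ∀ Ξ →
          ⊢ Ξ ⟨ Δ₁ ++ fm A ∷ Δ₂ ⟩ ⇒ D →
          ⊢ Ξ ⟨ Δ₁ ++ fm (A ∧ B) ∷ Δ₂ ⟩ ⇒ D
    ∧L₂ : ∀ Ξ →
          ⊢ Ξ ⟨ Δ₁ ++ fm B ∷ Δ₂ ⟩ ⇒ D →
          ⊢ Ξ ⟨ Δ₁ ++ fm (A ∧ B) ∷ Δ₂ ⟩ ⇒ D
    ∧R  : ⊢ Θ ⇒ A →
          ⊢ Θ ⇒ B →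
          ⊢ Θ ⇒ A ∧ B
    ∨L  : ∀ Ξ →
          ⊢ Ξ ⟨ Δ₁ ++ fm A ∷ Δ₂ ⟩ ⇒ D →
          ⊢ Ξ ⟨ Δ₁ ++ fm B ∷ Δ₂ ⟩ ⇒ D →
          ⊢ Ξ ⟨ Δ₁ ++ fm (A ∨ B) ∷ Δ₂ ⟩ ⇒ D
    ∨R₁ : ⊢ Θ ⇒ A →
          ⊢ Θ ⇒ A ∨ B
    ∨R₂ : ⊢ Θ ⇒ B →
          ⊢ Θ ⇒ A ∨ B

    []⁻¹L : ∀ Ξ →
            ⊢ Ξ ⟨ Δ₁ ++ fm A ∷ Δ₂ ⟩ ⇒ B →
            ⊢ Ξ ⟨ Δ₁ ++ ⟦ [ fm ([]⁻¹ A) ] ⟧ ∷ Δ₂ ⟩ ⇒ B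
    []⁻¹R : ⊢ [ ⟦ Θ ⟧ ] ⇒ A →
            ⊢ Θ ⇒ []⁻¹ A
    ⟨⟩L   : ∀ Ξ →
            ⊢ Ξ ⟨ Δ₁ ++ ⟦ [ fm A ] ⟧ ∷ Δ₂ ⟩ ⇒ B →
            ⊢ Ξ ⟨ Δ₁ ++ fm (⟨⟩ A) ∷ Δ₂ ⟩ ⇒ B
    ⟨⟩R   : ⊢ Θ ⇒ A →
            ⊢ [ ⟦ Θ ⟧ ] ⇒ ⟨⟩ A

    !L  : ∀ Ξ →
          ⊢ Ξ ⟨ Δ₁ ++ fm A ∷ Δ₂ ⟩ ⇒ C →
          ⊢ Ξ ⟨ Δ₁ ++ fm (! A) ∷ Δ₂ ⟩ ⇒ C
    !R  : ⊢ [ fm (! A) ] ⇒ B →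
          ⊢ [ fm (! A) ] ⇒ ! B
    !P₁ : ∀ Ξ →
          ⊢ Ξ ⟨ Δ₁ ++ fm (! A) ∷ Φ ++ Δ₂ ⟩ ⇒ C →
          ⊢ Ξ ⟨ Δ₁ ++ Φ ++ fm (! A) ∷ Δ₂ ⟩ ⇒ C
    !P₂ : ∀ Ξ →
          ⊢ Ξ ⟨ Δ₁ ++ Φ ++ fm (! A) ∷ Δ₂ ⟩ ⇒ C →
          ⊢ Ξ ⟨ Δ₁ ++ fm (! A) ∷ Φ ++ Δ₂ ⟩ ⇒ C
    !C  : ∀ Ξ → Side r (Γ₂ ≢ Λ) →
          ⊢ Ξ ⟨ fm (! A) ∷ Γ₁ ++ ⟦ fm (! A) ∷ Γ₂ ⟧ ∷ Γ₃ ⟩ ⇒ C →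
          ⊢ Ξ ⟨ fm (! A) ∷ Γ₁ ++ ⟦ [ ⟦ Γ₂ ⟧ ] ⟧ ∷ Γ₃ ⟩ ⇒ C

    cut : ∀ Ξ →
          ⊢ Π ⇒ A →
          ⊢ Ξ ⟨ Γ₁ ++ fm A ∷ Γ₂ ⟩ ⇒ C →
          ⊢ Ξ ⟨ Γ₁ ++ Π ++ Γ₂ ⟩ ⇒ C

  data OneDivisionTree : Tree → Set where
    fm  : OneDivision A → OneDivisionTree (fm A)
    ⟦_⟧ : All OneDivisionTree Γ → OneDivisionTree ⟦ Γ ⟧

  OneDivisionSequent : Sequent → Set
  OneDivisionSequent (Γ ⇒ C) = All OneDivisionTree Γ × OneDivision C

  mutual
    encodeTree : Tree → List Symbol
    encodeTree (fm A) = encodeFormula A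
    encodeTree ⟦ Γ ⟧  = open′ ∷ encodeMeta Γ ++ [ close ]

    encodeMeta : Meta → List Symbol
    encodeMeta []      = []
    encodeMeta (T ∷ Γ) = encodeTree T ++ encodeMeta Γ

  encode : Sequent → List Symbol
  encode (Γ ⇒ C) = encodeMeta Γ ++ arrow ∷ encodeFormula C

-- The encodings are injective.  Words are parsed from right to left onto a
-- stack of lists of trees; a stoup is parsed as a list of formula trees.

module Parser {Tree : Set} (r : Restriction) (fm : Formula r → Tree)
              (formula : Tree → Formula r)
              (formula-fm : ∀ A → formula (fm A) ≡ A)
              (bracket : List (List Tree) → List (List Tree)) where

  Stack : Set
  Stack = List (List Tree)

  unary : (Formula r → Formula r) → Stack → Stack
  unary f ((S ∷ Γ) ∷ s) = (fm (f (formula S)) ∷ Γ) ∷ s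
  unary f s             = s

  binary : (Formula r → Formula r → Formula r) → Stack → Stack
  binary f ((S ∷ T ∷ Γ) ∷ s) = (fm (f (formula S) (formula T)) ∷ Γ) ∷ s
  binary f s                 = s

  push : Formula r → Stack → Stack
  push A (Γ ∷ s) = (fm A ∷ Γ) ∷ s
  push A []      = []

  unit : ∀ r′ → r ≡ r′ → Stack → Stack
  unit none   refl s = push 𝟏 s
  unit lambek _    s = s

  next : Formula r → Formula r
  next (var n) = var (suc n)
  next A       = A

  step : Symbol → Stack → Stack
  step tick      = unary next
  step v         = push (var 0)
  step one       = unit r refl
  step under     = binary _⧵_
  step over      = binary _/_
  step times     = binary _·_
  step and       = binary _∧_
  step or        = binary _∨_
  step dia       = unary ⟨⟩_
  step box       = unary []⁻¹_
  step bang      = unary !_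
  step open′     = bracket
  step semicolon = [] ∷_
  step close     = [] ∷_
  step arrow     = [] ∷_

  parse : List Symbol → Stack → Stack
  parse w s = foldr step s w

  parse-++ : ∀ u w s → parse (u ++ w) s ≡ parse u (parse w s)
  parse-++ u w s = foldr-++ step s u w

  unit-𝟏 : ∀ r′ (eq : r ≡ r′) {u : HasUnit r} Γ s →
           unit r′ eq (Γ ∷ s) ≡ (fm (𝟏 {u = u}) ∷ Γ) ∷ s
  unit-𝟏 none   refl     Γ s = refl
  unit-𝟏 lambek refl {()} Γ s

  mutual
    parse-formula : ∀ A Γ s →
                    parse (encodeFormula A) (Γ ∷ s) ≡ (fm A ∷ Γ) ∷ s
    parse-formula (var zero)    Γ s = refl
    parse-formula (var (suc n)) Γ s
      rewrite parse-formula (var n) Γ s | formula-fm (var n) = refl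
    parse-formula 𝟏        Γ s = unit-𝟏 r refl Γ s
    parse-formula (A ⧵ B)  Γ s = parse-binary _⧵_ A B Γ s
    parse-formula (A / B)  Γ s = parse-binary _/_ A B Γ s
    parse-formula (A · B)  Γ s = parse-binary _·_ A B Γ s
    parse-formula (A ∧ B)  Γ s = parse-binary _∧_ A B Γ s
    parse-formula (A ∨ B)  Γ s = parse-binary _∨_ A B Γ s
    parse-formula (⟨⟩ A)   Γ s = parse-unary ⟨⟩_ A Γ s
    parse-formula ([]⁻¹ A) Γ s = parse-unary []⁻¹_ A Γ s
    parse-formula (! A)    Γ s = parse-unary !_ A Γ s

    parse-unary : ∀ f A Γ s →
                  unary f (parse (encodeFormula A) (Γ ∷ s)) ≡ (fm (f A) ∷ Γ) ∷ s
    parse-unary f A Γ s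
      rewrite parse-formula A Γ s | formula-fm A = refl

    parse-binary : ∀ f A B Γ s →
                   binary f (parse (encodeFormula A ++ encodeFormula B) (Γ ∷ s)) ≡
                   (fm (f A B) ∷ Γ) ∷ s
    parse-binary f A B Γ s
      rewrite parse-++ (encodeFormula A) (encodeFormula B) (Γ ∷ s)
            | parse-formula B Γ s
            | parse-formula A (fm B ∷ Γ) s
            | formula-fm A | formula-fm B = refl

module StoupEncoding (r : Restriction) where
  open Stoup r

  formula : Tree → Formula r
  formula (fm A) = A
  formula ⟦ _ ⟧  = var 0

  bracket : List (List Tree) → List (List Tree)
  bracket (Δ ∷ Γ ∷ Γ′ ∷ s) = (⟦ map formula Δ ⨾ Γ ⟧ ∷ Γ′) ∷ s
  bracket s                = s

  open Parser r fm formula (λ _ → refl) bracket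

  map-formula-fm : ∀ ζ → map formula (map fm ζ) ≡ ζ
  map-formula-fm []      = refl
  map-formula-fm (A ∷ ζ) = cong (A ∷_) (map-formula-fm ζ)

  parse-stoup : ∀ ζ s → parse (encodeStoup ζ) ([] ∷ s) ≡ map fm ζ ∷ s
  parse-stoup []      s = refl
  parse-stoup (A ∷ ζ) s
    rewrite parse-++ (encodeFormula A) (encodeStoup ζ) ([] ∷ s)
          | parse-stoup ζ s = parse-formula A (map fm ζ) s

  mutual
    parse-tree : ∀ T Γ s → parse (encodeTree T) (Γ ∷ s) ≡ (T ∷ Γ) ∷ s
    parse-tree (fm A)    Γ s = parse-formula A Γ s
    parse-tree ⟦ ζ ⨾ Δ ⟧ Γ s
      rewrite parse-++ (encodeMeta (ζ ⨾ Δ)) [ close ] (Γ ∷ s)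
            | parse-meta ζ Δ (Γ ∷ s)
            | map-formula-fm ζ = refl

    parse-trees : ∀ Γ s → parse (encodeTrees Γ) ([] ∷ s) ≡ Γ ∷ s
    parse-trees []      s = refl
    parse-trees (T ∷ Γ) s
      rewrite parse-++ (encodeTree T) (encodeTrees Γ) ([] ∷ s)
            | parse-trees Γ s = parse-tree T Γ s

    parse-meta : ∀ ζ Γ s →
                 parse (encodeMeta (ζ ⨾ Γ)) ([] ∷ s) ≡ map fm ζ ∷ Γ ∷ s
    parse-meta ζ Γ s
      rewrite parse-++ (encodeStoup ζ) (semicolon ∷ encodeTrees Γ) ([] ∷ s)
            | parse-trees Γ s = parse-stoup ζ (Γ ∷ s)

  result : List (List Tree) → Sequent
  result (Δ ∷ Γ ∷ (T ∷ _) ∷ _) = map formula Δ ⨾ Γ ⇒ formula T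
  result _                     = ∅ ⨾ Λ ⇒ var 0

  decode : List Symbol → Sequent
  decode w = result (parse w [ [] ])

  decode-encode : ∀ S → decode (encode S) ≡ S
  decode-encode (ζ ⨾ Γ ⇒ C)
    rewrite parse-++ (encodeMeta (ζ ⨾ Γ)) (arrow ∷ encodeFormula C) [ [] ]
          | parse-formula C [] []
          | parse-meta ζ Γ [ [ fm C ] ]
          | map-formula-fm ζ = refl

  encode-injective : Injective _≡_ _≡_ encode
  encode-injective {S} {S′} eq =
    trans (sym (decode-encode S)) (trans (cong decode eq) (decode-encode S′))

module StoupFreeEncoding (r : Restriction) where
  open StoupFree r

  formula : Tree → Formula r
  formula (fm A) = A
  formula ⟦ _ ⟧  = var 0

  bracket : List (List Tree) → List (List Tree)
  bracket (Γ ∷ Γ′ ∷ s) = (⟦ Γ ⟧ ∷ Γ′) ∷ s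
  bracket s            = s

  open Parser r fm formula (λ _ → refl) bracket

  mutual
    parse-tree : ∀ T Γ s → parse (encodeTree T) (Γ ∷ s) ≡ (T ∷ Γ) ∷ s
    parse-tree (fm A) Γ s = parse-formula A Γ s
    parse-tree ⟦ Δ ⟧  Γ s
      rewrite parse-++ (encodeMeta Δ) [ close ] (Γ ∷ s)
            | parse-meta Δ (Γ ∷ s) = refl

    parse-meta : ∀ Γ s → parse (encodeMeta Γ) ([] ∷ s) ≡ Γ ∷ s
    parse-meta []      s = refl
    parse-meta (T ∷ Γ) s
      rewrite parse-++ (encodeTree T) (encodeMeta Γ) ([] ∷ s)
            | parse-meta Γ s = parse-tree T Γ s

  result : List (List Tree) → Sequent
  result (Γ ∷ (T ∷ _) ∷ _) = Γ ⇒ formula T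
  result _                 = Λ ⇒ var 0

  decode : List Symbol → Sequent
  decode w = result (parse w [ [] ])

  decode-encode : ∀ S → decode (encode S) ≡ S
  decode-encode (Γ ⇒ C)
    rewrite parse-++ (encodeMeta Γ) (arrow ∷ encodeFormula C) [ [] ]
          | parse-formula C [] []
          | parse-meta Γ [ [ fm C ] ] = refl

  encode-injective : Injective _≡_ _≡_ encode
  encode-injective {S} {S′} eq =
    trans (sym (decode-encode S)) (trans (cong decode eq) (decode-encode S′))

-- Deterministic one-tape Turing machines, the tape being infinite in both
-- directions

data Cell (X : Set) (k : ℕ) : Set where
  blank : Cell X k
  input : X → Cell X k
  aux   : Fin k → Cell X k

data Direction : Set where
  left right : Direction

data Action (X : Set) (states auxiliary : ℕ) : Set where
  halt : (accept : Bool) → Action X states auxiliary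
  move : Fin states → Cell X auxiliary → Direction → Action X states auxiliary

-- The input alphabet X is meant to be finite.
record TuringMachine (X : Set) : Set where
  field
    states    : ℕ
    auxiliary : ℕ
    start     : Fin states
    action    : Fin states → Cell X auxiliary → Action X states auxiliary

module Run {X : Set} (M : TuringMachine X) where
  open TuringMachine M

  -- 'before' lists the cells to the left of the head, nearest first; all
  -- cells not listed are blank.
  record Tape : Set where
    constructor tape
    field
      before : List (Cell X auxiliary)
      head   : Cell X auxiliary
      after  : List (Cell X auxiliary)

  shift : Direction → Tape → Tape
  shift left  (tape []       c rs)       = tape [] blank (c ∷ rs)
  shift left  (tape (l ∷ ls) c rs)       = tape ls l (c ∷ rs)
  shift right (tape ls       c [])       = tape (c ∷ ls) blank []
  shift right (tape ls       c (r ∷ rs)) = tape (c ∷ ls) r rs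

  write : Cell X auxiliary → Tape → Tape
  write c t = record t { head = c }

  initial : List X → Tape
  initial []      = tape [] blank []
  initial (x ∷ w) = tape [] (input x) (map input w)

  data Halts : Fin states → Tape → Bool → Set where
    halt : ∀ {q t b} → action q (Tape.head t) ≡ halt b → Halts q t b
    move : ∀ {q t b q′ c d} → action q (Tape.head t) ≡ move q′ c d →
           Halts q′ (shift d (write c t)) b → Halts q t b

  Accepts Rejects : List X → Set
  Accepts w = Halts start (initial w) true
  Rejects w = Halts start (initial w) false

-- M decides P on the instances satisfying I, an instance being given to M as
-- the word 'code' assigns to it.
Decides : {X Instance : Set} → TuringMachine X → (Instance → List X) →
          (I P : Instance → Set) → Set
Decides M code I P = ∀ x → I x → (P x → Accepts (code x)) × (¬ P x → Rejects (code x))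
  where open Run M

record Calculus : Set₁ where
  field
    Sequent             : Set
    Derivable           : Sequent → Set
    OneDivisionFragment : Sequent → Set
    encode              : Sequent → List Symbol
    encode-injective    : Injective _≡_ _≡_ encode

stoupFreeCalculus : Restriction → Calculus
stoupFreeCalculus r = record
  { Sequent             = Sequent
  ; Derivable           = ⊢_
  ; OneDivisionFragment = OneDivisionSequent
  ; encode              = encode
  ; encode-injective    = StoupFreeEncoding.encode-injective r
  }
  where open StoupFree r

stoupCalculus : ∀ r → (Stoup.Sequent r → Stoup.Sequent r → Set) → Calculus
stoupCalculus r Rule = record
  { Sequent             = Sequent
  ; Derivable           = Stoup.Calculus.⊢_ r Rule
  ; OneDivisionFragment = OneDivisionSequent
  ; encode              = encode
  ; encode-injective    = StoupEncoding.encode-injective r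
  }
  where open Stoup r

F₂₀₁₈ F⁻₂₀₁₈ M₂₀₁₈ M′₂₀₁₈ M′⁻₂₀₁₈ : Calculus
F₂₀₁₈   = stoupFreeCalculus none
F⁻₂₀₁₈  = stoupFreeCalculus lambek
M₂₀₁₈   = stoupCalculus none   (Stoup.Rule₂₀₁₈ none)
M′₂₀₁₈  = stoupCalculus none   (Stoup.Rule′₂₀₁₈ none)
M′⁻₂₀₁₈ = stoupCalculus lambek (Stoup.Rule′₂₀₁₈ lambek)

OneDivisionFragmentUndecidable : Calculus → Set
OneDivisionFragmentUndecidable K =
  ¬ (∃ λ (M : TuringMachine Symbol) → Decides M encode OneDivisionFragment Derivable)
  where open Calculus K

{-# OPTIONS --safe #-}

-- A queue system removes a word from the front of the current word and appends
-- another one at the back.  The word a b c … is represented by the antecedent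
-- [[a]], [[b]], [[c]], …, whose double brackets pay for the contractions that
-- supply the rule formulas; the formula A = []⁻¹ (s / (s / ⟨⟩⟨⟩ b)) / a turns
-- [[a]], Γ ⇒ s into Γ, [[b]] ⇒ s.  So the sequent of a word is derivable if the
-- word can be rewritten to the empty word.  The converse is soundness of the
-- interpretation of formulas by languages in which brackets are ignored and ! A
-- denotes at most the empty word; it validates all five calculi, with cut.
--
-- A decider M is refuted by diagonalisation.  The rule formulas come first in
-- the text of a sequent, so a queue system started on a coding of that text can
-- append the text of this very word, thus obtaining the text of its own
-- sequent, run M on it, and vanish iff M rejects.

module Submission where

open import Defs
open import Data.Bool using (Bool; true; false)
open import Data.Fin using (Fin; toℕ)
open import Data.Fin.Properties using (toℕ-injective)
open import Data.List using (List; []; _∷_; _++_; [_]; map; concat; concatMap; lookup; allFin; cartesianProductWith; reverse; _ʳ++_)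
open import Data.List.Membership.Propositional using (_∈_)
open import Data.List.Membership.Propositional.Properties using (∈-map⁺; ∈-map⁻; ∈-∃++; ∈-concat⁺; ∈-++⁺ˡ; ∈-++⁺ʳ; ∈-cartesianProductWith⁺; ∈-allFin)
open import Data.List.Properties using (++-assoc; ++-identityʳ; ++-conicalˡ; ++-conicalʳ; map-++; map-∘; reverse-map; reverse-involutive; ʳ++-defn; concatMap-++; concatMap-map)
open import Data.List.Relation.Binary.Permutation.Propositional using (↭-sym)
open import Data.List.Relation.Binary.Permutation.Propositional.Properties using (All-resp-↭) renaming (shift to ↭-shift)
open import Data.List.Relation.Unary.All as All using (All; []; _∷_)
open import Data.List.Relation.Unary.All.Properties using (++⁺; ++⁻)
open import Data.List.Relation.Unary.Any using (Any; index; here; there)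
open import Data.List.Relation.Unary.Any.Properties using (lookup-index)
open import Data.Nat using (ℕ; zero; suc)
open import Data.Product using (_×_; _,_; ∃; ∃₂; proj₁; proj₂)
open import Data.Sum using (_⊎_; inj₁; inj₂)
open import Data.Unit using (tt)
open import Function using (_∘_; _⇔_; mk⇔; Equivalence)
open import Function.Properties.Equivalence using (⇔-setoid)
open import Relation.Binary using (Setoid)
import Relation.Binary.Construct.On as On
import Relation.Binary.Reasoning.Setoid as ≈-Reasoning
open import Relation.Binary.PropositionalEquality
  using (_≡_; _≢_; refl; sym; trans; cong; cong₂; subst; subst₂; module ≡-Reasoning)
open import Relation.Nullary using (¬_)

-- Finite enumerations and queue systems

record Enumeration (A : Set) : Set where
  field
    elements : List A
    complete : ∀ a → a ∈ elements

  code : A → ℕ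
  code a = toℕ (index (complete a))

  -- `elements` may contain repetitions, but looking up the position recorded by `code a` always
  -- returns `a`.
  code-injective : ∀ {a b} → code a ≡ code b → a ≡ b
  code-injective {a} {b} eq = begin
    a                                     ≡⟨ lookup-index (complete a) ⟩
    lookup elements (index (complete a))  ≡⟨ cong (lookup elements) (toℕ-injective eq) ⟩
    lookup elements (index (complete b))  ≡⟨ lookup-index (complete b) ⟨
    b                                     ∎
    where open ≡-Reasoning

-- `first` is kept apart from `rest` because a rule must read at least one letter: the double
-- bracket of that letter hosts the contraction.
record QueueSystem : Set₁ where
  field
    Letter Rule : Set
    letters     : Enumeration Letter
    rules       : Enumeration Rule
    first       : Rule → Letter
    rest output : Rule → List Letter

  data Vanishes : List Letter → Set where
    empty : Vanishes []
    apply : ∀ ρ {w} → Vanishes (w ++ output ρ) → Vanishes (first ρ ∷ rest ρ ++ w)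

-- Concatenation products of languages

module _ {X : Set} where

  -- The product, under concatenation, of the languages `R a` along a list.
  data ⨂ {A : Set} (R : A → List X → Set) : List A → List X → Set where
    []  : ⨂ R [] []
    _∷_ : ∀ {a as u₁ u₂} → R a u₁ → ⨂ R as u₂ → ⨂ R (a ∷ as) (u₁ ++ u₂)

  module _ {A : Set} {R : A → List X → Set} where

    ⨂-++⁺ : ∀ {as bs u₁ u₂} → ⨂ R as u₁ → ⨂ R bs u₂ → ⨂ R (as ++ bs) (u₁ ++ u₂)
    ⨂-++⁺ []                                qs = qs
    ⨂-++⁺ {u₂ = u} (_∷_ {u₁ = u₁} {u₂} p ps) qs =
      subst (⨂ R _) (sym (++-assoc u₁ u₂ u)) (p ∷ ⨂-++⁺ ps qs)

    ⨂-++⁻ : ∀ as {bs w} → ⨂ R (as ++ bs) w →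
            ∃₂ λ u₁ u₂ → w ≡ u₁ ++ u₂ × ⨂ R as u₁ × ⨂ R bs u₂
    ⨂-++⁻ []       ps = [] , _ , refl , [] , ps
    ⨂-++⁻ (a ∷ as) (_∷_ {u₁ = u} p ps) with ⨂-++⁻ as ps
    ... | u₁ , u₂ , refl , qs , rs = u ++ u₁ , u₂ , sym (++-assoc u u₁ u₂) , p ∷ qs , rs

    ⨂-[-]⁺ : ∀ {a w} → R a w → ⨂ R [ a ] w
    ⨂-[-]⁺ p = subst (⨂ R _) (++-identityʳ _) (p ∷ [])

    ⨂-[-]⁻ : ∀ {a w} → ⨂ R [ a ] w → R a w
    ⨂-[-]⁻ (p ∷ []) = subst (R _) (sym (++-identityʳ _)) p

    -- The returned function stands for the surrounding factors: any segment that holds of the same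
    -- factor `u` may take the place of `bs`. The left rules of the calculi are treated as such
    -- exchanges.
    ⨂-focus : ∀ as {bs cs w} → ⨂ R (as ++ bs ++ cs) w →
              ∃ λ u → ⨂ R bs u × (∀ {bs′} → ⨂ R bs′ u → ⨂ R (as ++ bs′ ++ cs) w)
    ⨂-focus as {bs} ps with ⨂-++⁻ as ps
    ... | _ , _ , refl , qs , qs′ with ⨂-++⁻ bs qs′
    ... | u , _ , refl , rs , rs′ = u , rs , λ rs″ → ⨂-++⁺ qs (⨂-++⁺ rs″ rs′)

-- Lets one derivation serve both restrictions: the side condition is always proved, and forgotten
-- for `none`.
side : ∀ r {P : Set} → P → Side r P
side none   p = tt
side lambek p = p

-- Interpretation of formulas by languages

module Languages {X : Set} (V : ℕ → List X → Set) where

  -- The empty word is neutral for concatenation, so a factor `! A` may be moved and copied without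
  -- changing the word.
  ⟦_⟧ᶠ : ∀ {r} → Formula r → List X → Set
  ⟦ var n ⟧ᶠ  w = V n w
  ⟦ 𝟏 ⟧ᶠ      w = w ≡ []
  ⟦ A ⧵ B ⟧ᶠ  w = ∀ {u} → ⟦ A ⟧ᶠ u → ⟦ B ⟧ᶠ (u ++ w)
  ⟦ B / A ⟧ᶠ  w = ∀ {u} → ⟦ A ⟧ᶠ u → ⟦ B ⟧ᶠ (w ++ u)
  ⟦ A · B ⟧ᶠ  w = ∃₂ λ u₁ u₂ → w ≡ u₁ ++ u₂ × ⟦ A ⟧ᶠ u₁ × ⟦ B ⟧ᶠ u₂
  ⟦ A ∧ B ⟧ᶠ  w = ⟦ A ⟧ᶠ w × ⟦ B ⟧ᶠ w
  ⟦ A ∨ B ⟧ᶠ  w = ⟦ A ⟧ᶠ w ⊎ ⟦ B ⟧ᶠ w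
  ⟦ ⟨⟩ A ⟧ᶠ   w = ⟦ A ⟧ᶠ w
  ⟦ []⁻¹ A ⟧ᶠ w = ⟦ A ⟧ᶠ w
  ⟦ ! A ⟧ᶠ    w = w ≡ [] × ⟦ A ⟧ᶠ []

-- Soundness of the stoup-free calculi

module StoupFreeSoundness {X : Set} (V : ℕ → List X → Set) (r : Restriction) where
  open Languages V
  open StoupFree r

  infix 4 _⊨_ _⊨*_

  data _⊨_ : Tree → List X → Set where
    fm  : ∀ {w} → ⟦ A ⟧ᶠ w → fm A ⊨ w
    ⟦_⟧ : ∀ {w} → ⨂ _⊨_ Γ w → ⟦ Γ ⟧ ⊨ w

  _⊨*_ : Meta → List X → Set
  _⊨*_ = ⨂ _⊨_

  fm⁺ : ∀ {w} → ⟦ A ⟧ᶠ w → [ fm A ] ⊨* w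
  fm⁺ p = ⨂-[-]⁺ (fm p)

  fm⁻ : ∀ {w} → [ fm A ] ⊨* w → ⟦ A ⟧ᶠ w
  fm⁻ p with ⨂-[-]⁻ p
  ... | fm q = q

  bracket⁺ : ∀ {w} → Γ ⊨* w → [ ⟦ Γ ⟧ ] ⊨* w
  bracket⁺ p = ⨂-[-]⁺ ⟦ p ⟧

  bracket⁻ : ∀ {w} → [ ⟦ Γ ⟧ ] ⊨* w → Γ ⊨* w
  bracket⁻ p with ⨂-[-]⁻ p
  ... | ⟦ q ⟧ = q

  focus : ∀ Ξ {Θ w} → Ξ ⟨ Θ ⟩ ⊨* w →
          ∃ λ u → Θ ⊨* u × (∀ {Θ′} → Θ′ ⊨* u → Ξ ⟨ Θ′ ⟩ ⊨* w)
  focus ∙           p = _ , p , λ q → q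
  focus (Γ ⟦ Ξ ⟧ Δ) p with ⨂-focus Γ {bs = [ _ ]} p
  ... | _ , q , k with focus Ξ (bracket⁻ q)
  ... | u , q′ , k′ = u , q′ , λ q″ → k (bracket⁺ (k′ q″))

  replace : ∀ Ξ {Θ Θ′ w} → (∀ {u} → Θ ⊨* u → Θ′ ⊨* u) → Ξ ⟨ Θ ⟩ ⊨* w → Ξ ⟨ Θ′ ⟩ ⊨* w
  replace Ξ f p with focus Ξ p
  ... | _ , q , k = k (f q)

  replace-++ : ∀ Ξ Δ₁ Φ {Φ′ w} → (∀ {u} → Φ ⊨* u → Φ′ ⊨* u) →
               Ξ ⟨ Δ₁ ++ Φ ++ Δ₂ ⟩ ⊨* w → Ξ ⟨ Δ₁ ++ Φ′ ++ Δ₂ ⟩ ⊨* w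
  replace-++ Ξ Δ₁ Φ f = replace Ξ λ p → let _ , q , k = ⨂-focus Δ₁ {bs = Φ} p in k (f q)

  -- The last factor is the empty word, so the whole word stays the same when that factor comes
  -- first.
  bang-first : ∀ Φ {w} → Φ ++ [ fm (! A) ] ⊨* w → fm (! A) ∷ Φ ⊨* w
  bang-first Φ p with ⨂-++⁻ Φ p
  ... | _ , _ , refl , qs , rs with fm⁻ rs
  ... | refl , a = subst (_ ⊨*_) (sym (++-identityʳ _)) (fm (refl , a) ∷ qs)

  bang-last : ∀ Φ {w} → fm (! A) ∷ Φ ⊨* w → Φ ++ [ fm (! A) ] ⊨* w
  bang-last Φ (fm (refl , a) ∷ ps) =
    subst (_ ⊨*_) (++-identityʳ _) (⨂-++⁺ ps (fm⁺ (refl , a)))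

  contract : ∀ Γ₁ {w} → fm (! A) ∷ Γ₁ ++ ⟦ [ ⟦ Γ₂ ⟧ ] ⟧ ∷ Γ₃ ⊨* w →
             fm (! A) ∷ Γ₁ ++ ⟦ fm (! A) ∷ Γ₂ ⟧ ∷ Γ₃ ⊨* w
  contract Γ₁ (fm (refl , a) ∷ ps) with ⨂-focus Γ₁ {bs = [ _ ]} ps
  ... | _ , q , k =
    fm (refl , a) ∷ k (bracket⁺ (fm (refl , a) ∷ bracket⁻ (bracket⁻ q)))

  -- Induction on the derivation. Read upwards, a left rule or a cut replaces a segment of the
  -- antecedent by one that holds of the same word.
  sound : ⊢ Γ ⇒ C → ∀ {w} → Γ ⊨* w → ⟦ C ⟧ᶠ w
  sound ax p = fm⁻ p
  sound 𝟏R [] = refl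
  sound (𝟏L {Δ₁ = Δ₁} Ξ d) p =
    sound d (replace-++ Ξ Δ₁ [ _ ] {Φ′ = []} (λ q → subst ([] ⊨*_) (sym (fm⁻ q)) []) p)
  sound (/L {Γ = Γ} {Δ₁ = Δ₁} Ξ d e) p =
    sound e (replace-++ Ξ Δ₁ (_ ∷ Γ) (λ { (fm f ∷ qs) → fm⁺ (f (sound d qs)) }) p)
  sound (/R _ d) p q = sound d (⨂-++⁺ p (fm⁺ q))
  sound (⧵L {Γ = Γ} {A = A} {Δ₁ = Δ₁} {C = C} {Δ₂ = Δ₂} Ξ d e) p =
    sound e (replace Ξ (λ q → lemma (⨂-focus Δ₁ {bs = Γ ++ [ fm (A ⧵ C) ]}
      (subst (λ Θ → Δ₁ ++ Θ ⊨* _) (sym (++-assoc Γ [ fm (A ⧵ C) ] Δ₂)) q))) p)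
    where
    lemma : ∀ {w} → (∃ λ u → Γ ++ [ fm (A ⧵ C) ] ⊨* u ×
              (∀ {Φ} → Φ ⊨* u → Δ₁ ++ Φ ++ Δ₂ ⊨* w)) → Δ₁ ++ fm C ∷ Δ₂ ⊨* w
    lemma (_ , q , k) with ⨂-++⁻ Γ q
    ... | _ , _ , refl , qs , rs = k (fm⁺ (fm⁻ rs (sound d qs)))
  sound (⧵R _ d) p q = sound d (fm q ∷ p)
  sound (·L {Δ₁ = Δ₁} Ξ d) p = sound d (replace-++ Ξ Δ₁ [ _ ] (λ q → lemma (fm⁻ q)) p)
    where
    lemma : ∀ {w} → ⟦ A · B ⟧ᶠ w → fm A ∷ [ fm B ] ⊨* w
    lemma (_ , _ , refl , a , b) = fm a ∷ fm⁺ b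
  sound (·R {Δ = Δ} d e) p with ⨂-++⁻ Δ p
  ... | _ , _ , eq , q , q′ = _ , _ , eq , sound d q , sound e q′
  sound (∧L₁ {Δ₁ = Δ₁} Ξ d) p =
    sound d (replace-++ Ξ Δ₁ [ _ ] (λ q → fm⁺ (proj₁ (fm⁻ q))) p)
  sound (∧L₂ {Δ₁ = Δ₁} Ξ d) p =
    sound d (replace-++ Ξ Δ₁ [ _ ] (λ q → fm⁺ (proj₂ (fm⁻ q))) p)
  sound (∧R d e) p = sound d p , sound e p
  sound (∨L {Δ₁ = Δ₁} Ξ d e) p with focus Ξ p
  ... | _ , q , k with ⨂-focus Δ₁ {bs = [ _ ]} q
  ... | _ , q′ , k′ with fm⁻ q′
  ... | inj₁ a = sound d (k (k′ (fm⁺ a)))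
  ... | inj₂ b = sound e (k (k′ (fm⁺ b)))
  sound (∨R₁ d) p = inj₁ (sound d p)
  sound (∨R₂ d) p = inj₂ (sound d p)
  sound ([]⁻¹L {Δ₁ = Δ₁} Ξ d) p =
    sound d (replace-++ Ξ Δ₁ [ _ ] (λ q → fm⁺ (fm⁻ (bracket⁻ q))) p)
  sound ([]⁻¹R d) p = sound d (bracket⁺ p)
  sound (⟨⟩L {Δ₁ = Δ₁} Ξ d) p =
    sound d (replace-++ Ξ Δ₁ [ _ ] (λ q → bracket⁺ (fm⁺ (fm⁻ q))) p)
  sound (⟨⟩R d) p = sound d (bracket⁻ p)
  sound (!L {Δ₁ = Δ₁} {A = A} Ξ d) p = sound d (replace-++ Ξ Δ₁ [ _ ] (λ q → lemma (fm⁻ q)) p)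
    where
    lemma : ∀ {w} → ⟦ ! A ⟧ᶠ w → [ fm A ] ⊨* w
    lemma (refl , a) = fm⁺ a
  sound (!R d) p with fm⁻ p
  ... | refl , _ = refl , sound d p
  sound (!P₁ {Δ₁ = Δ₁} {A = A} {Φ = Φ} {Δ₂ = Δ₂} Ξ d) p =
    sound d (replace Ξ (λ q → replace-++ ∙ Δ₁ (Φ ++ [ fm (! A) ]) (bang-first Φ)
      (subst (λ Θ → Δ₁ ++ Θ ⊨* _) (sym (++-assoc Φ [ fm (! A) ] Δ₂)) q)) p)
  sound (!P₂ {Δ₁ = Δ₁} {Φ = Φ} {A = A} {Δ₂ = Δ₂} Ξ d) p =
    sound d (replace Ξ (λ q → subst (λ Θ → Δ₁ ++ Θ ⊨* _) (++-assoc Φ [ fm (! A) ] Δ₂)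
      (replace-++ ∙ Δ₁ (fm (! A) ∷ Φ) (bang-last Φ) q)) p)
  sound (!C {Γ₁ = Γ₁} Ξ _ d) p = sound d (replace Ξ (contract Γ₁) p)
  sound (cut {Π = Π} {Γ₁ = Γ₁} Ξ d e) p =
    sound e (replace-++ Ξ Γ₁ Π (λ q → fm⁺ (sound d q)) p)

-- Soundness of the stoup calculi

module StoupSoundness {X : Set} (V : ℕ → List X → Set) (r : Restriction) where
  open Languages V
  open Stoup r

  infix 4 _⊨_ _⊨*_
  infix 3 _⊨ᵐ_

  ε∈_ : Formula r → Set
  ε∈ A = ⟦ A ⟧ᶠ []

  mutual
    data _⊨_ : Tree → List X → Set where
      fm  : ∀ {w} → ⟦ A ⟧ᶠ w → fm A ⊨ w
      ⟦_⟧ : ∀ {w} → Θ ⊨ᵐ w → ⟦ Θ ⟧ ⊨ w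

    -- A formula in a stoup behaves like one under `!`: it contributes the empty word, which must
    -- lie in its language.
    data _⊨ᵐ_ : Meta → List X → Set where
      _⨾_ : ∀ {w} → All ε∈_ ζ → ⨂ _⊨_ Γ w → ζ ⨾ Γ ⊨ᵐ w

  _⊨*_ : List Tree → List X → Set
  _⊨*_ = ⨂ _⊨_

  fm⁺ : ∀ {w} → ⟦ A ⟧ᶠ w → [ fm A ] ⊨* w
  fm⁺ p = ⨂-[-]⁺ (fm p)

  fm⁻ : ∀ {w} → [ fm A ] ⊨* w → ⟦ A ⟧ᶠ w
  fm⁻ p with ⨂-[-]⁻ p
  ... | fm q = q

  bracket⁺ : ∀ {w} → Θ ⊨ᵐ w → [ ⟦ Θ ⟧ ] ⊨* w
  bracket⁺ p = ⨂-[-]⁺ ⟦ p ⟧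

  bracket⁻ : ∀ {w} → [ ⟦ Θ ⟧ ] ⊨* w → Θ ⊨ᵐ w
  bracket⁻ p with ⨂-[-]⁻ p
  ... | ⟦ q ⟧ = q

  focus : ∀ Ξ {Θ w} → Ξ ⟨ Θ ⟩ ⊨ᵐ w →
          ∃ λ u → Θ ⊨ᵐ u × (∀ {Θ′} → Θ′ ⊨ᵐ u → Ξ ⟨ Θ′ ⟩ ⊨ᵐ w)
  focus ∙               p        = _ , p , λ q → q
  focus (ζ ⨾ Γ ⟦ Ξ ⟧ Δ) (as ⨾ p) with ⨂-focus Γ {bs = [ _ ]} p
  ... | _ , q , k with focus Ξ (bracket⁻ q)
  ... | u , q′ , k′ = u , q′ , λ q″ → as ⨾ k (bracket⁺ (k′ q″))

  replace : ∀ Ξ {Θ Θ′ w} → (∀ {u} → Θ ⊨ᵐ u → Θ′ ⊨ᵐ u) → Ξ ⟨ Θ ⟩ ⊨ᵐ w → Ξ ⟨ Θ′ ⟩ ⊨ᵐ w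
  replace Ξ f p with focus Ξ p
  ... | _ , q , k = k (f q)

  replace-++ : ∀ Ξ Δ₁ Φ {Φ′ w} → (∀ {u} → All ε∈_ ζ → Φ ⊨* u → All ε∈_ ζ′ × Φ′ ⊨* u) →
               Ξ ⟨ ζ ⨾ Δ₁ ++ Φ ++ Δ₂ ⟩ ⊨ᵐ w → Ξ ⟨ ζ′ ⨾ Δ₁ ++ Φ′ ++ Δ₂ ⟩ ⊨ᵐ w
  replace-++ Ξ Δ₁ Φ f = replace Ξ λ { (as ⨾ p) →
    let _ , q , k = ⨂-focus Δ₁ {bs = Φ} p
        as′ , q′  = f as q
    in as′ ⨾ k q′ }

  replace-tree : ∀ Ξ Δ₁ {T Φ w} → (∀ {u} → [ T ] ⊨* u → Φ ⊨* u) →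
                 Ξ ⟨ ζ ⨾ Δ₁ ++ T ∷ Δ₂ ⟩ ⊨ᵐ w → Ξ ⟨ ζ ⨾ Δ₁ ++ Φ ++ Δ₂ ⟩ ⊨ᵐ w
  replace-tree Ξ Δ₁ f = replace-++ Ξ Δ₁ [ _ ] (λ as q → as , f q)

  -- The copy of `A` adds only the empty word to the bracket. Both contraction rules are covered,
  -- `!C` being the case of empty `ζ′`.
  duplicate : ∀ Ξ Γ₁ {w} →
              Ξ ⟨ A ∷ ζ ⨾ Γ₁ ++ ⟦ ∅ ⨾ [ ⟦ ζ′ ⨾ Γ₂ ⟧ ] ⟧ ∷ Γ₃ ⟩ ⊨ᵐ w →
              Ξ ⟨ A ∷ ζ ⨾ Γ₁ ++ ⟦ A ∷ ζ′ ⨾ Γ₂ ⟧ ∷ Γ₃ ⟩ ⊨ᵐ w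
  duplicate {A = A} Ξ Γ₁ = replace-++ Ξ Γ₁ [ _ ] λ where
      (a ∷ as) q → a ∷ as , bracket⁺ (lemma a (bracket⁻ q))
    where
    lemma : ∀ {w} → ε∈ A → ∅ ⨾ [ ⟦ ζ′ ⨾ Γ₂ ⟧ ] ⊨ᵐ w → A ∷ ζ′ ⨾ Γ₂ ⊨ᵐ w
    lemma a ([] ⨾ q) with bracket⁻ q
    ... | bs ⨾ q′ = a ∷ bs ⨾ q′

  Valid : Sequent → Set
  Valid (Θ ⇒ C) = ∀ {w} → Θ ⊨ᵐ w → ⟦ C ⟧ᶠ w

  Sound : (Sequent → Sequent → Set) → Set
  Sound Rule = ∀ {S S′} → Rule S S′ → Valid S → Valid S′

  rule₂₀₁₈-sound : Sound Rule₂₀₁₈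
  rule₂₀₁₈-sound !R ih ([] ⨾ p) with fm⁻ p
  ... | refl , _ = refl , ih ([] ⨾ p)
  rule₂₀₁₈-sound (!C {Γ₁ = Γ₁} Ξ) ih p = ih (duplicate Ξ Γ₁ p)

  rule′₂₀₁₈-sound : Sound Rule′₂₀₁₈
  rule′₂₀₁₈-sound !R′ ih (as ⨾ [])          = refl , ih (as ⨾ [])
  rule′₂₀₁₈-sound (!C′ {Γ₁ = Γ₁} Ξ _) ih p = ih (duplicate Ξ Γ₁ p)

  module _ {Rule : Sequent → Sequent → Set} (rule-sound : Sound Rule) where
    open Stoup.Calculus r Rule

    sound : ∀ {S} → ⊢ S → Valid S
    sound (exchange Ξ ζ↭ζ′ d) p =
      sound d (replace Ξ (λ { (as ⨾ q) → All-resp-↭ (↭-sym ζ↭ζ′) as ⨾ q }) p)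
    sound ax ([] ⨾ p) = fm⁻ p
    sound 𝟏R ([] ⨾ []) = refl
    sound (𝟏L {Δ₁ = Δ₁} Ξ d) p =
      sound d (replace-tree Ξ Δ₁ {Φ = []} (λ q → subst ([] ⊨*_) (sym (fm⁻ q)) []) p)
    sound (/L {ζ₁ = ζ₁} {Γ = Γ} {Δ₁ = Δ₁} Ξ d e) p =
      sound e (replace-++ Ξ Δ₁ (_ ∷ Γ)
        (λ { as (fm f ∷ qs) → let as₁ , as₂ = ++⁻ ζ₁ as in
             as₂ , fm⁺ (f (sound d (as₁ ⨾ qs))) }) p)
    sound (/R _ d) (as ⨾ p) q = sound d (as ⨾ ⨂-++⁺ p (fm⁺ q))
    sound (⧵L {ζ₁ = ζ₁} {Γ = Γ} {A = A} {ζ₂ = ζ₂} {Δ₁ = Δ₁} {C = C} {Δ₂ = Δ₂} Ξ d e) p =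
      sound e (replace-++ Ξ Δ₁ (Γ ++ [ fm (A ⧵ C) ]) lemma
        (subst (λ Φ → Ξ ⟨ ζ₁ ++ ζ₂ ⨾ Δ₁ ++ Φ ⟩ ⊨ᵐ _) (sym (++-assoc Γ [ fm (A ⧵ C) ] Δ₂)) p))
      where
      lemma : ∀ {u} → All ε∈_ (ζ₁ ++ ζ₂) → Γ ++ [ fm (A ⧵ C) ] ⊨* u →
              All ε∈_ ζ₂ × [ fm C ] ⊨* u
      lemma as q with ++⁻ ζ₁ as | ⨂-++⁻ Γ q
      ... | as₁ , as₂ | _ , _ , refl , qs , rs = as₂ , fm⁺ (fm⁻ rs (sound d (as₁ ⨾ qs)))
    sound (⧵R _ d) (as ⨾ p) q = sound d (as ⨾ (fm q ∷ p))
    sound (·L {Δ₁ = Δ₁} Ξ d) p = sound d (replace-tree Ξ Δ₁ (λ q → lemma (fm⁻ q)) p)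
      where
      lemma : ∀ {w} → ⟦ A · B ⟧ᶠ w → fm A ∷ [ fm B ] ⊨* w
      lemma (_ , _ , refl , a , b) = fm a ∷ fm⁺ b
    sound (·R {ζ₁ = ζ₁} {Δ = Δ} d e) (as ⨾ p) with ++⁻ ζ₁ as | ⨂-++⁻ Δ p
    ... | as₁ , as₂ | _ , _ , eq , q , q′ = _ , _ , eq , sound d (as₁ ⨾ q) , sound e (as₂ ⨾ q′)
    sound (∧L₁ {Δ₁ = Δ₁} Ξ d) p =
      sound d (replace-tree Ξ Δ₁ (λ q → fm⁺ (proj₁ (fm⁻ q))) p)
    sound (∧L₂ {Δ₁ = Δ₁} Ξ d) p =
      sound d (replace-tree Ξ Δ₁ (λ q → fm⁺ (proj₂ (fm⁻ q))) p)
    sound (∧R d e) p = sound d p , sound e p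
    sound (∨L {Δ₁ = Δ₁} Ξ d e) p with focus Ξ p
    ... | _ , (as ⨾ q) , k with ⨂-focus Δ₁ {bs = [ _ ]} q
    ... | _ , q′ , k′ with fm⁻ q′
    ... | inj₁ a = sound d (k (as ⨾ k′ (fm⁺ a)))
    ... | inj₂ b = sound e (k (as ⨾ k′ (fm⁺ b)))
    sound (∨R₁ d) p = inj₁ (sound d p)
    sound (∨R₂ d) p = inj₂ (sound d p)
    sound ([]⁻¹L {Δ₁ = Δ₁} Ξ d) p = sound d (replace-tree Ξ Δ₁ (λ q → lemma (bracket⁻ q)) p)
      where
      lemma : ∀ {w} → ∅ ⨾ [ fm ([]⁻¹ A) ] ⊨ᵐ w → [ fm A ] ⊨* w
      lemma ([] ⨾ q) = fm⁺ (fm⁻ q)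
    sound ([]⁻¹R d) p = sound d ([] ⨾ bracket⁺ p)
    sound (⟨⟩L {Δ₁ = Δ₁} Ξ d) p =
      sound d (replace-tree Ξ Δ₁ (λ q → bracket⁺ ([] ⨾ fm⁺ (fm⁻ q))) p)
    sound (⟨⟩R d) ([] ⨾ p) = sound d (bracket⁻ p)
    sound (!L {A = A} {Γ₁ = Γ₁} Ξ d) p =
      sound d (replace-++ Ξ Γ₁ [ _ ] {Φ′ = []} (λ as q → lemma as (fm⁻ q)) p)
      where
      lemma : ∀ {w} → All ε∈_ ζ → ⟦ ! A ⟧ᶠ w → All ε∈_ (A ∷ ζ) × [] ⊨* w
      lemma as (refl , a) = a ∷ as , []
    sound (!P {Γ₁ = Γ₁} Ξ d) p =
      sound d (replace-++ Ξ Γ₁ [] (λ { (a ∷ as) [] → as , fm⁺ a }) p)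
    sound (rule ρ d) p = rule-sound ρ (sound d) p

-- Formulas coding the rules of a queue system

-- Without weakening every formula under ! must eventually be used, which is
-- what 'closing' does.  It consumes ! ruleFormula ρ rather than ruleFormula ρ,
-- whose language need not be contained in { ε }, and therefore the rule
-- formulas carry two !'s in the sequents: the stoup calculi cannot restore the
-- ! of a formula taken from the stoup.
module RuleFormulas (Q : QueueSystem) (r : Restriction) where
  open QueueSystem Q
  open Enumeration letters using (code; code-injective)
  open Enumeration rules using (elements; complete)

  goal : Formula r
  goal = var 0

  letter : Letter → Formula r
  letter a = var (suc (code a))

  -- On the left of a sequent this formula consumes `w` at the front of the queue, on the right it
  -- appends `w` at the back. The outermost division is by the first letter, which keeps the order
  -- in both uses.
  reading : Formula r → List Letter → Formula r
  reading B []      = B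
  reading B (a ∷ w) = reading B w / ⟨⟩ ⟨⟩ letter a

  -- Contraction puts this formula next to `letter (first ρ)` in a single bracket; the division uses
  -- up the letter, and `[]⁻¹L` then removes the bracket. Once `rest ρ` is read,
  -- `goal / reading goal (output ρ)` asks for `goal` from the remaining queue followed by
  -- `output ρ`.
  ruleFormula : Rule → Formula r
  ruleFormula ρ = []⁻¹ (reading (goal / reading goal (output ρ)) (rest ρ)) / letter (first ρ)

  closing : List Rule → Formula r
  closing []       = goal
  closing (ρ ∷ ρs) = closing ρs / ! ruleFormula ρ

  banged : List (Formula r)
  banged = closing elements ∷ map (λ ρ → ! ruleFormula ρ) elements

  reading-oneDivision : ∀ {B} → OneDivision B → ∀ w → OneDivision (reading B w)
  reading-oneDivision o []      = o
  reading-oneDivision o (a ∷ w) = reading-oneDivision o w / (⟨⟩ ⟨⟩ var _)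

  ruleFormula-oneDivision : ∀ ρ → OneDivision (ruleFormula ρ)
  ruleFormula-oneDivision ρ =
    ([]⁻¹ reading-oneDivision (var 0 / reading-oneDivision (var 0) (output ρ)) (rest ρ)) / var _

  closing-oneDivision : ∀ ρs → OneDivision (closing ρs)
  closing-oneDivision []       = var 0
  closing-oneDivision (ρ ∷ ρs) = closing-oneDivision ρs / (! ruleFormula-oneDivision ρ)

  banged-oneDivision : All OneDivision banged
  banged-oneDivision = closing-oneDivision elements ∷ All.tabulate lemma
    where
    lemma : ∀ {A} → A ∈ map (λ ρ → ! ruleFormula ρ) elements → OneDivision A
    lemma A∈ with ∈-map⁻ _ A∈
    ... | ρ , _ , refl = ! ruleFormula-oneDivision ρ

  -- With `goal` read as the set of vanishing words, soundness for the sequent of `w` says that `w`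
  -- vanishes.
  valuation : ℕ → List Letter → Set
  valuation zero    w = Vanishes w
  valuation (suc n) w = ∃ λ a → w ≡ [ a ] × code a ≡ n

  open Languages valuation

  letter⁺ : ∀ a → ⟦ letter a ⟧ᶠ [ a ]
  letter⁺ a = a , refl , refl

  letter⁻ : ∀ a {w} → ⟦ letter a ⟧ᶠ w → w ≡ [ a ]
  letter⁻ a (b , refl , eq) = cong [_] (code-injective eq)

  -- `letter a` denotes only the word `[ a ]`, so `reading B w` denotes the right quotient of `B` by
  -- `w`.
  reading⁻ : ∀ B w {u} → ⟦ reading B w ⟧ᶠ u → ⟦ B ⟧ᶠ (u ++ w)
  reading⁻ B []      {u} p = subst ⟦ B ⟧ᶠ (sym (++-identityʳ u)) p
  reading⁻ B (a ∷ w) {u} p =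
    subst ⟦ B ⟧ᶠ (++-assoc u [ a ] w) (reading⁻ B w (p (letter⁺ a)))

  reading⁺ : ∀ B w {u} → ⟦ B ⟧ᶠ (u ++ w) → ⟦ reading B w ⟧ᶠ u
  reading⁺ B []      {u} p = subst ⟦ B ⟧ᶠ (++-identityʳ u) p
  reading⁺ B (a ∷ w) {u} p q with letter⁻ a q
  ... | refl = reading⁺ B w (subst ⟦ B ⟧ᶠ (sym (++-assoc u [ a ] w)) p)

  -- With the divisions unfolded this is the closure of `Vanishes` under `apply ρ`.
  ε∈ruleFormula : ∀ ρ → ⟦ ruleFormula ρ ⟧ᶠ []
  ε∈ruleFormula ρ q with letter⁻ (first ρ) q
  ... | refl = reading⁺ (goal / reading goal (output ρ)) (rest ρ)
                 λ p → apply ρ (reading⁻ goal (output ρ) p)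

  ε∈closing : ∀ ρs → ⟦ closing ρs ⟧ᶠ []
  ε∈closing []       = empty
  ε∈closing (ρ ∷ ρs) (refl , _) = ε∈closing ρs

  ε∈banged : All (λ A → ⟦ A ⟧ᶠ []) banged
  ε∈banged = ε∈closing elements ∷ All.tabulate lemma
    where
    lemma : ∀ {A} → A ∈ map (λ ρ → ! ruleFormula ρ) elements → ⟦ A ⟧ᶠ []
    lemma A∈ with ∈-map⁻ _ A∈
    ... | ρ , _ , refl = refl , ε∈ruleFormula ρ

-- Reduction of vanishing to stoup-free derivability

-- The text depends on the code of the letter alone, so it is available before the queue system
-- whose rules output such texts.
stoupFreeLetterText : Restriction → ℕ → List Symbol
stoupFreeLetterText r n = encodeTree ⟦ [ ⟦ [ fm (var (suc n)) ] ⟧ ] ⟧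
  where open StoupFree r

module StoupFreeReduction (Q : QueueSystem) (r : Restriction) where
  open QueueSystem Q
  open Enumeration letters using (code)
  open Enumeration rules using (elements; complete)
  open RuleFormulas Q r
  open StoupFree r
  open StoupFreeSoundness valuation r

  letterTree : Letter → Tree
  letterTree a = ⟦ [ ⟦ [ fm (letter a) ] ⟧ ] ⟧

  bangs : List (Formula r) → Meta
  bangs = map (λ A → fm (! A))

  sequent : List Letter → Sequent
  sequent w = bangs banged ++ map letterTree w ⇒ goal

  bangs-oneDivision : ∀ {As} → All OneDivision As → All OneDivisionTree (bangs As)
  bangs-oneDivision []       = []
  bangs-oneDivision (o ∷ os) = fm (! o) ∷ bangs-oneDivision os

  letters-oneDivision : ∀ w → All OneDivisionTree (map letterTree w)
  letters-oneDivision []      = []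
  letters-oneDivision (a ∷ w) = ⟦ ⟦ fm (var _) ∷ [] ⟧ ∷ [] ⟧ ∷ letters-oneDivision w

  sequent-oneDivision : ∀ w → OneDivisionSequent (sequent w)
  sequent-oneDivision w =
    ++⁺ (bangs-oneDivision banged-oneDivision) (letters-oneDivision w) , var 0

  bangs⊨ : ∀ {As} → All (λ A → Languages.⟦_⟧ᶠ valuation A []) As → bangs As ⊨* []
  bangs⊨ []       = []
  bangs⊨ (p ∷ ps) = fm (refl , p) ∷ bangs⊨ ps

  letters⊨ : ∀ w → map letterTree w ⊨* w
  letters⊨ []      = []
  letters⊨ (a ∷ w) = ⟦ bracket⁺ (fm⁺ (letter⁺ a)) ⟧ ∷ letters⊨ w

  -- The formulas under `!` contribute the empty word and the letter trees contribute `w`, so `w`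
  -- lies in the language of `goal`.
  derivable⇒vanishes : ∀ w → ⊢ sequent w → Vanishes w
  derivable⇒vanishes w d = sound d (⨂-++⁺ (bangs⊨ ε∈banged) (letters⊨ w))

  -- `!P₂` moves one formula at a time; `Γ` collects those already in place.
  bangs-leftwards : ∀ Γ As Φ → ⊢ Γ ++ Φ ++ bangs As ++ Δ ⇒ C → ⊢ Γ ++ bangs As ++ Φ ++ Δ ⇒ C
  bangs-leftwards         Γ []       Φ d = d
  bangs-leftwards {Δ} {C} Γ (A ∷ As) Φ d =
    subst (λ Θ → ⊢ Θ ⇒ C) (++-assoc Γ [ fm (! A) ] _)
      (bangs-leftwards (Γ ++ [ fm (! A) ]) As Φ
        (subst (λ Θ → ⊢ Θ ⇒ C) (sym (++-assoc Γ [ fm (! A) ] _))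
          (!P₂ {Δ₁ = Γ} {Φ = Φ} ∙ d)))

  -- `!C` needs its `! A` to stand first, so the formula is brought to the front, contracted and
  -- returned to its place.
  contraction : ∀ {A As} → A ∈ As → Γ₂ ≢ Λ →
                ⊢ bangs As ++ ⟦ fm (! A) ∷ Γ₂ ⟧ ∷ Δ ⇒ C →
                ⊢ bangs As ++ ⟦ [ ⟦ Γ₂ ⟧ ] ⟧ ∷ Δ ⇒ C
  contraction A∈As Γ₂≢Λ d with ∈-∃++ A∈As
  contraction {Γ₂ = Γ₂} {Δ = Δ} {C = C} {A = A} A∈As Γ₂≢Λ d | As₁ , As₂ , refl =
    backwards _ (!P₁ {Δ₁ = []} {Φ = bangs As₁} ∙
      (subst (λ Θ → ⊢ fm (! A) ∷ Θ ⇒ C) (++-assoc (bangs As₁) (bangs As₂) _)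
        (!C ∙ (side r Γ₂≢Λ)
          (subst (λ Θ → ⊢ fm (! A) ∷ Θ ⇒ C) (sym (++-assoc (bangs As₁) (bangs As₂) _))
            (!P₂ {Δ₁ = []} {Φ = bangs As₁} ∙ (forwards _ d))))))
    where
    eq : ∀ Δ → bangs (As₁ ++ A ∷ As₂) ++ Δ ≡ bangs As₁ ++ fm (! A) ∷ bangs As₂ ++ Δ
    eq Δ = trans (cong (_++ Δ) (map-++ _ As₁ (A ∷ As₂))) (++-assoc (bangs As₁) _ Δ)
    forwards : ∀ Δ → ⊢ bangs (As₁ ++ A ∷ As₂) ++ Δ ⇒ C →
               ⊢ bangs As₁ ++ fm (! A) ∷ bangs As₂ ++ Δ ⇒ C
    forwards Δ = subst (λ Θ → ⊢ Θ ⇒ C) (eq Δ)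
    backwards : ∀ Δ → ⊢ bangs As₁ ++ fm (! A) ∷ bangs As₂ ++ Δ ⇒ C →
                ⊢ bangs (As₁ ++ A ∷ As₂) ++ Δ ⇒ C
    backwards Δ = subst (λ Θ → ⊢ Θ ⇒ C) (sym (eq Δ))

  closing-derivable : ∀ ρs → ⊢ fm (closing ρs) ∷ bangs (map (λ ρ → ! ruleFormula ρ) ρs) ⇒ goal
  closing-derivable []       = ax
  closing-derivable (ρ ∷ ρs) =
    /L {Δ₁ = []} ∙ (!L {Δ₁ = []} ∙ ax) (closing-derivable ρs)

  -- Read upwards, `/R` puts a letter at the right end and two uses of `⟨⟩L` give it its brackets.
  -- `Γ ≢ Λ` meets Lambek's restriction on `/R`.
  reading-right : ∀ w {Γ} → Γ ≢ Λ → ⊢ Γ ++ map letterTree w ⇒ B → ⊢ Γ ⇒ reading B w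
  reading-right     []      {Γ} Γ≢Λ d = subst (λ Θ → ⊢ Θ ⇒ _) (++-identityʳ Γ) d
  reading-right {B} (a ∷ w) {Γ} Γ≢Λ d = /R (side r Γ≢Λ)
    (⟨⟩L {Δ₁ = Γ} ∙ (⟨⟩L {Δ₁ = []} (_⟦_⟧_ Γ ∙ Λ)
      (reading-right w (λ eq → Γ≢Λ (++-conicalˡ Γ _ eq))
        (subst (λ Θ → ⊢ Θ ⇒ B) (sym (++-assoc Γ [ letterTree a ] (map letterTree w))) d))))

  reading-left : ∀ w → ⊢ fm B ∷ Δ ⇒ C → ⊢ fm (reading B w) ∷ map letterTree w ++ Δ ⇒ C
  reading-left []      d = d
  reading-left (a ∷ w) d = /L {Δ₁ = []} ∙ (⟨⟩R (⟨⟩R ax)) (reading-left w d)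

  appending : ∀ w u → ⊢ bangs banged ++ map letterTree (u ++ w) ⇒ goal →
              ⊢ bangs banged ++ map letterTree u ⇒ reading goal w
  -- `banged` starts with the closing formula, so the antecedent is non-empty even when `u` is
  -- empty.
  appending w u d = reading-right w (λ ()) (subst (λ Θ → ⊢ Θ ⇒ goal) eq d)
    where
    eq : bangs banged ++ map letterTree (u ++ w) ≡
         (bangs banged ++ map letterTree u) ++ map letterTree w
    eq = trans (cong (bangs banged ++_) (map-++ letterTree u w))
               (sym (++-assoc (bangs banged) _ _))

  vanishes⇒derivable : ∀ {w} → Vanishes w → ⊢ sequent w
  vanishes⇒derivable empty =
    subst (λ Θ → ⊢ Θ ⇒ goal) (sym (++-identityʳ (bangs banged)))
      (!L {Δ₁ = []} ∙ (closing-derivable elements))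
  vanishes⇒derivable (apply ρ {w} p) =
    contraction (there (∈-map⁺ _ (complete ρ))) (λ ())
      (subst (λ Φ → ⊢ bangs banged ++ _ ∷ Φ ⇒ goal) (sym (map-++ letterTree (rest ρ) w))
        -- Read upwards, the formulas under `!` pass the letters that the rule reads and stay with
        -- the remaining queue, where later steps use them.
        (bangs-leftwards [] banged (_ ∷ map letterTree (rest ρ))
          -- The contracted formula carries two `!`, hence two uses of `!L`.
          (!L {Δ₁ = []} bracket (!L {Δ₁ = []} bracket
            (/L {Δ₁ = []} bracket ax ([]⁻¹L {Δ₁ = []} ∙ (reading-left (rest ρ) appended)))))))
    where
    bracket : Context
    bracket = _⟦_⟧_ [] ∙ (map letterTree (rest ρ) ++ bangs banged ++ map letterTree w)
    appended : ⊢ fm (goal / reading goal (output ρ)) ∷ bangs banged ++ map letterTree w ⇒ goal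
    appended = subst (λ Θ → ⊢ fm (goal / reading goal (output ρ)) ∷ Θ ⇒ goal)
      (++-identityʳ (bangs banged ++ map letterTree w))
      (/L {Δ₁ = []} ∙ (appending (output ρ) w (vanishes⇒derivable p)) ax)

  prefix : List Symbol
  prefix = encodeFormula (closing elements) ++
           encodeMeta (bangs (map (λ ρ → ! ruleFormula ρ) elements))

  encodeMeta-++ : ∀ Γ Δ → encodeMeta (Γ ++ Δ) ≡ encodeMeta Γ ++ encodeMeta Δ
  encodeMeta-++ []      Δ = refl
  encodeMeta-++ (T ∷ Γ) Δ =
    trans (cong (encodeTree T ++_) (encodeMeta-++ Γ Δ)) (sym (++-assoc (encodeTree T) _ _))

  encode-letters : ∀ w → encodeMeta (map letterTree w) ≡ concatMap (stoupFreeLetterText r ∘ code) w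
  encode-letters []      = refl
  encode-letters (a ∷ w) = cong (stoupFreeLetterText r (code a) ++_) (encode-letters w)

  encode-sequent : ∀ w → encode (sequent w) ≡
                   bang ∷ prefix ++ concatMap (stoupFreeLetterText r ∘ code) w ++ arrow ∷ v ∷ []
  encode-sequent w = begin
    encodeMeta (bangs banged ++ map letterTree w) ++ arrow ∷ v ∷ []
      ≡⟨ cong (_++ arrow ∷ v ∷ []) (encodeMeta-++ (bangs banged) (map letterTree w)) ⟩
    (bang ∷ prefix ++ encodeMeta (map letterTree w)) ++ arrow ∷ v ∷ []
      ≡⟨ ++-assoc (bang ∷ prefix) _ _ ⟩
    bang ∷ prefix ++ encodeMeta (map letterTree w) ++ arrow ∷ v ∷ []
      ≡⟨ cong (λ s → bang ∷ prefix ++ s ++ arrow ∷ v ∷ []) (encode-letters w) ⟩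
    bang ∷ prefix ++ concatMap (stoupFreeLetterText r ∘ code) w ++ arrow ∷ v ∷ []
      ∎
    where open ≡-Reasoning

-- Reduction of vanishing to derivability with stoups

stoupLetterText : Restriction → ℕ → List Symbol
stoupLetterText r n = encodeTree ⟦ ∅ ⨾ [ ⟦ ∅ ⨾ [ fm (var (suc n)) ] ⟧ ] ⟧
  where open Stoup r

-- The instance common to `!C` and `!C′`: contraction at the outermost level into a leading double
-- bracket with empty inner stoup.
Contracts : ∀ r → (Stoup.Sequent r → Stoup.Sequent r → Set) → Set
Contracts r Rule = ∀ {A B ζ Γ Δ} → Γ ≢ Λ →
  Rule (A ∷ ζ ⨾ ⟦ [ A ] ⨾ Γ ⟧ ∷ Δ ⇒ B) (A ∷ ζ ⨾ ⟦ ∅ ⨾ [ ⟦ ∅ ⨾ Γ ⟧ ] ⟧ ∷ Δ ⇒ B)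
  where open Stoup r

module StoupReduction (Q : QueueSystem) (r : Restriction) where
  open QueueSystem Q
  open Enumeration letters using (code)
  open Enumeration rules using (elements; complete)
  open RuleFormulas Q r
  open Stoup r
  open StoupSoundness valuation r

  letterTree : Letter → Tree
  letterTree a = ⟦ ∅ ⨾ [ ⟦ ∅ ⨾ [ fm (letter a) ] ⟧ ] ⟧

  bangs : List (Formula r) → List Tree
  bangs = map (λ A → fm (! A))

  sequent : List Letter → Sequent
  sequent w = ∅ ⨾ bangs banged ++ map letterTree w ⇒ goal

  bangs-oneDivision : ∀ {As} → All OneDivision As → All OneDivisionTree (bangs As)
  bangs-oneDivision []       = []
  bangs-oneDivision (o ∷ os) = fm (! o) ∷ bangs-oneDivision os

  letters-oneDivision : ∀ w → All OneDivisionTree (map letterTree w)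
  letters-oneDivision []      = []
  letters-oneDivision (a ∷ w) =
    ⟦ [] ⨾ (⟦ [] ⨾ (fm (var _) ∷ []) ⟧ ∷ []) ⟧ ∷ letters-oneDivision w

  sequent-oneDivision : ∀ w → OneDivisionSequent (sequent w)
  sequent-oneDivision w =
    ([] ⨾ ++⁺ (bangs-oneDivision banged-oneDivision) (letters-oneDivision w)) , var 0

  bangs⊨ : ∀ {As} → All ε∈_ As → bangs As ⊨* []
  bangs⊨ []       = []
  bangs⊨ (p ∷ ps) = fm (refl , p) ∷ bangs⊨ ps

  letters⊨ : ∀ w → map letterTree w ⊨* w
  letters⊨ []      = []
  letters⊨ (a ∷ w) = ⟦ [] ⨾ bracket⁺ ([] ⨾ fm⁺ (letter⁺ a)) ⟧ ∷ letters⊨ w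

  prefix : List Symbol
  prefix = encodeTrees (bangs banged)

  encodeTrees-++ : ∀ Γ Δ → encodeTrees (Γ ++ Δ) ≡ encodeTrees Γ ++ encodeTrees Δ
  encodeTrees-++ []      Δ = refl
  encodeTrees-++ (T ∷ Γ) Δ =
    trans (cong (encodeTree T ++_) (encodeTrees-++ Γ Δ)) (sym (++-assoc (encodeTree T) _ _))

  encode-letters : ∀ w → encodeTrees (map letterTree w) ≡ concatMap (stoupLetterText r ∘ code) w
  encode-letters []      = refl
  encode-letters (a ∷ w) = cong (stoupLetterText r (code a) ++_) (encode-letters w)

  encode-sequent : ∀ w → encode (sequent w) ≡
                   semicolon ∷ prefix ++ concatMap (stoupLetterText r ∘ code) w ++ arrow ∷ v ∷ []
  encode-sequent w = begin
    semicolon ∷ encodeTrees (bangs banged ++ map letterTree w) ++ arrow ∷ v ∷ []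
      ≡⟨ cong (λ s → semicolon ∷ s ++ arrow ∷ v ∷ [])
              (encodeTrees-++ (bangs banged) (map letterTree w)) ⟩
    semicolon ∷ (prefix ++ encodeTrees (map letterTree w)) ++ arrow ∷ v ∷ []
      ≡⟨ cong (semicolon ∷_) (++-assoc prefix _ _) ⟩
    semicolon ∷ prefix ++ encodeTrees (map letterTree w) ++ arrow ∷ v ∷ []
      ≡⟨ cong (λ s → semicolon ∷ prefix ++ s ++ arrow ∷ v ∷ []) (encode-letters w) ⟩
    semicolon ∷ prefix ++ concatMap (stoupLetterText r ∘ code) w ++ arrow ∷ v ∷ []
      ∎
    where open ≡-Reasoning

  module _
    {Rule₀ : Sequent → Sequent → Set}
    (rule-sound : Sound Rule₀)
    (contract : Contracts r Rule₀)
    where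
    open Stoup.Calculus r Rule₀

    derivable⇒vanishes : ∀ w → ⊢ sequent w → Vanishes w
    derivable⇒vanishes w d =
      sound rule-sound d ([] ⨾ ⨂-++⁺ (bangs⊨ ε∈banged) (letters⊨ w))

    bangs-stoup : ∀ As → ⊢ As ++ ζ ⨾ Δ ⇒ C → ⊢ ζ ⨾ bangs As ++ Δ ⇒ C
    bangs-stoup     []       d = d
    bangs-stoup {ζ} (A ∷ As) d =
      !L {Γ₁ = []} ∙ (bangs-stoup As (exchange ∙ (↭-sym (↭-shift A As ζ)) d))

    contraction : A ∈ ζ → Γ ≢ Λ →
                  ⊢ ζ ⨾ ⟦ [ A ] ⨾ Γ ⟧ ∷ Δ ⇒ C →
                  ⊢ ζ ⨾ ⟦ ∅ ⨾ [ ⟦ ∅ ⨾ Γ ⟧ ] ⟧ ∷ Δ ⇒ C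
    contraction {A} A∈ζ Γ≢Λ d with ∈-∃++ A∈ζ
    ... | ζ₁ , ζ₂ , refl =
      exchange ∙ (↭-sym (↭-shift A ζ₁ ζ₂))
        (rule (contract Γ≢Λ) (exchange ∙ (↭-shift A ζ₁ ζ₂) d))

    closing-derivable : ∀ ρs → ⊢ map (λ ρ → ! ruleFormula ρ) ρs ⨾ [ fm (closing ρs) ] ⇒ goal
    closing-derivable []       = ax
    closing-derivable (ρ ∷ ρs) =
      /L {Δ₁ = []} ∙ (!P {Γ₁ = []} ∙ ax) (closing-derivable ρs)

    -- Here the non-empty stoup meets the restriction on `/R`; the sequence itself may be empty, as
    -- it is once the queue is used up.
    reading-right : ∀ w {Γ} → ζ ≢ ∅ → ⊢ ζ ⨾ Γ ++ map letterTree w ⇒ B → ⊢ ζ ⨾ Γ ⇒ reading B w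
    reading-right {ζ}     []      {Γ} ζ≢∅ d = subst (λ Θ → ⊢ ζ ⨾ Θ ⇒ _) (++-identityʳ Γ) d
    reading-right {ζ} {B} (a ∷ w) {Γ} ζ≢∅ d = /R (side r (inj₂ ζ≢∅))
      (⟨⟩L {Δ₁ = Γ} ∙ (⟨⟩L {Δ₁ = []} (_⨾_⟦_⟧_ ζ Γ ∙ Λ)
        (reading-right w ζ≢∅
          (subst (λ Θ → ⊢ ζ ⨾ Θ ⇒ B) (sym (++-assoc Γ [ letterTree a ] (map letterTree w))) d))))

    reading-left : ∀ w → ⊢ ζ ⨾ fm B ∷ Δ ⇒ C → ⊢ ζ ⨾ fm (reading B w) ∷ map letterTree w ++ Δ ⇒ C
    reading-left []      d = d
    reading-left (a ∷ w) d = /L {Δ₁ = []} ∙ (⟨⟩R (⟨⟩R ax)) (reading-left w d)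

    vanishes⇒derivable-stoup : ∀ {w} → Vanishes w → ⊢ banged ⨾ map letterTree w ⇒ goal
    vanishes⇒derivable-stoup empty = !P {Γ₁ = []} ∙ (closing-derivable elements)
    vanishes⇒derivable-stoup (apply ρ {w} p) =
      contraction (there (∈-map⁺ _ (complete ρ))) (λ ())
        (subst (λ Φ → ⊢ banged ⨾ _ ∷ Φ ⇒ goal) (sym (map-++ letterTree (rest ρ) w))
          -- Read upwards: `!P` releases `! ruleFormula ρ` from the stoup of the bracket, `!L` puts
          -- `ruleFormula ρ` there, and the second `!P` releases it.
          (!P {Γ₁ = []} bracket (!L {Γ₁ = []} bracket (!P {Γ₁ = []} bracket
            (/L {Δ₁ = []} bracket ax ([]⁻¹L {Δ₁ = []} ∙ (reading-left (rest ρ) appended)))))))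
      where
      bracket : Context
      bracket = _⨾_⟦_⟧_ banged [] ∙ (map letterTree (rest ρ) ++ map letterTree w)
      appending : ⊢ banged ⨾ map letterTree w ⇒ reading goal (output ρ)
      appending = reading-right (output ρ) (λ ())
        (subst (λ Θ → ⊢ banged ⨾ Θ ⇒ goal) (map-++ letterTree w (output ρ))
          (vanishes⇒derivable-stoup p))
      appended : ⊢ banged ⨾ fm (goal / reading goal (output ρ)) ∷ map letterTree w ⇒ goal
      appended = subst₂ (λ ζ Θ → ⊢ ζ ⨾ fm (goal / reading goal (output ρ)) ∷ Θ ⇒ goal)
        (++-identityʳ banged) (++-identityʳ (map letterTree w))
        -- The whole stoup goes to the premise for `reading goal (output ρ)`; the other premise is
        -- an axiom.
        (/L {ζ₂ = []} {Δ₁ = []} ∙ appending ax)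

    vanishes⇒derivable : ∀ {w} → Vanishes w → ⊢ sequent w
    vanishes⇒derivable {w} p = bangs-stoup banged
      (subst (λ ζ → ⊢ ζ ⨾ map letterTree w ⇒ goal) (sym (++-identityʳ banged))
        (vanishes⇒derivable-stoup p))

-- A queue system that builds a text and runs a Turing machine on it

concatenation : ∀ {A} (xss : List (List A)) → (∀ a → Any (a ∈_) xss) → Enumeration A
concatenation xss complete = record
  { elements = concat xss
  ; complete = λ a → ∈-concat⁺ (complete a)
  }

symbols : Enumeration Symbol
symbols = record
  { elements = tick ∷ v ∷ one ∷ under ∷ over ∷ times ∷ and ∷ or ∷ dia ∷ box ∷ bang ∷
               open′ ∷ semicolon ∷ close ∷ [ arrow ]
  ; complete = λ where
      tick      → here refl
      v         → there (here refl)
      one       → there (there (here refl))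
      under     → there (there (there (here refl)))
      over      → there (there (there (there (here refl))))
      times     → there (there (there (there (there (here refl)))))
      and       → there (there (there (there (there (there (here refl))))))
      or        → there (there (there (there (there (there (there (here refl)))))))
      dia       → there (there (there (there (there (there (there (there (here refl))))))))
      box       → there (there (there (there (there (there (there (there (there
                    (here refl)))))))))
      bang      → there (there (there (there (there (there (there (there (there (there
                    (here refl))))))))))
      open′     → there (there (there (there (there (there (there (there (there (there (there
                    (here refl)))))))))))
      semicolon → there (there (there (there (there (there (there (there (there (there (there
                    (there (here refl))))))))))))
      close     → there (there (there (there (there (there (there (there (there (there (there
                    (there (there (here refl)))))))))))))
      arrow     → there (there (there (there (there (there (there (there (there (there (there
                    (there (there (there (here refl))))))))))))))
  }

module Simulation (M : TuringMachine Symbol) (letterText : ℕ → List Symbol) where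
  open TuringMachine M
  open Run M
  open Enumeration

  -- 'copied σ' is a source letter that became a tape square of M; the squares
  -- 'cell c' hold the text appended for the sources and the cells written by M.
  data Square : Set where
    copied : Symbol → Square
    cell   : Cell Symbol auxiliary → Square

  content : Square → Cell Symbol auxiliary
  content (copied σ) = input σ
  content (cell c)   = c

  -- These letters may rotate from the front of the queue to the back. The `source` letters hold the
  -- text still to be copied, and `end` marks where the cyclic queue is cut.
  data Passive : Set where
    source : Symbol → Passive
    square : Square → Passive
    end    : Passive

  -- A right head rewrites together with the letter to its right, a left head
  -- together with the letter to its left.
  data RightHead : Set where
    carry : Symbol → RightHead
    run   : Fin states → RightHead

  data LeftHead : Set where
    fetch   : LeftHead
    retreat : Fin states → LeftHead

  -- `seed` starts the construction of the text. `eraser` swallows the queue after a rejection;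
  -- `stuck`, which no rule reads, blocks it after an acceptance.
  data Letter : Set where
    passive           : Passive → Letter
    rhead             : RightHead → Letter
    lhead             : LeftHead → Letter
    seed eraser stuck : Letter

  data Rule : Set where
    rotate : Passive → Rule
    right  : RightHead → Passive → Rule
    left   : Passive → LeftHead → Rule
    erase  : Passive → Rule
    expand : Rule
    finish : Rule

  cells : Enumeration (Cell Symbol auxiliary)
  cells = concatenation ([ blank ] ∷ map input (elements symbols) ∷ map aux (allFin auxiliary) ∷ [])
    λ where
      blank     → here (here refl)
      (input σ) → there (here (∈-map⁺ input (complete symbols σ)))
      (aux i)   → there (there (here (∈-map⁺ aux (∈-allFin i))))

  squares : Enumeration Square
  squares = concatenation (map copied (elements symbols) ∷ map cell (elements cells) ∷ [])
    λ where
      (copied σ) → here (∈-map⁺ copied (complete symbols σ))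
      (cell c)   → there (here (∈-map⁺ cell (complete cells c)))

  passives : Enumeration Passive
  passives = concatenation
    (map source (elements symbols) ∷ map square (elements squares) ∷ [ end ] ∷ [])
    λ where
      (source σ) → here (∈-map⁺ source (complete symbols σ))
      (square x) → there (here (∈-map⁺ square (complete squares x)))
      end        → there (there (here (here refl)))

  rightHeads : Enumeration RightHead
  rightHeads = concatenation (map carry (elements symbols) ∷ map run (allFin states) ∷ [])
    λ where
      (carry σ) → here (∈-map⁺ carry (complete symbols σ))
      (run q)   → there (here (∈-map⁺ run (∈-allFin q)))

  leftHeads : Enumeration LeftHead
  leftHeads = concatenation ([ fetch ] ∷ map retreat (allFin states) ∷ [])
    λ where
      fetch       → here (here refl)
      (retreat q) → there (here (∈-map⁺ retreat (∈-allFin q)))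

  letters : Enumeration Letter
  letters = concatenation
    (map passive (elements passives) ∷ map rhead (elements rightHeads) ∷
     map lhead (elements leftHeads) ∷ (seed ∷ eraser ∷ stuck ∷ []) ∷ [])
    λ where
      (passive a) → here (∈-map⁺ passive (complete passives a))
      (rhead q)   → there (here (∈-map⁺ rhead (complete rightHeads q)))
      (lhead q)   → there (there (here (∈-map⁺ lhead (complete leftHeads q))))
      seed        → there (there (there (here (here refl))))
      eraser      → there (there (there (here (there (here refl)))))
      stuck       → there (there (there (here (there (there (here refl))))))

  rules : Enumeration Rule
  rules = concatenation
    (map rotate (elements passives) ∷
     cartesianProductWith right (elements rightHeads) (elements passives) ∷
     cartesianProductWith left (elements passives) (elements leftHeads) ∷
     map erase (elements passives) ∷ (expand ∷ finish ∷ []) ∷ [])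
    λ where
      (rotate a)  → here (∈-map⁺ rotate (complete passives a))
      (right q a) → there (here
        (∈-cartesianProductWith⁺ right (complete rightHeads q) (complete passives a)))
      (left a q)  → there (there (here
        (∈-cartesianProductWith⁺ left (complete passives a) (complete leftHeads q))))
      (erase a)   → there (there (there (here (∈-map⁺ erase (complete passives a)))))
      expand      → there (there (there (there (here (here refl)))))
      finish      → there (there (there (there (here (there (here refl))))))

  text : Letter → List Symbol
  text a = letterText (code letters a)

  sourceText : Symbol → List Symbol
  sourceText σ = text (passive (source σ))

  texts : List Symbol → List Symbol
  texts = concatMap sourceText

  -- The initial queue ends with `seed`, so the text of its sequent ends like this.
  tail : List Symbol
  tail = text seed ++ arrow ∷ v ∷ []

  inputs : List Symbol → List Passive
  inputs = map (λ σ → square (cell (input σ)))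

  copies : List Symbol → List Passive
  copies = map (λ σ → square (copied σ))

  -- The answer of `M` is turned around: the queue is blocked on acceptance and erased on rejection.
  -- A left move is completed by `retreat` together with the next letter to the left.
  act : Action Symbol states auxiliary → List Letter
  act (halt true)      = [ stuck ]
  act (halt false)     = [ eraser ]
  act (move q c left)  = lhead (retreat q) ∷ passive (square (cell c)) ∷ []
  act (move q c right) = passive (square (cell c)) ∷ rhead (run q) ∷ []

  -- `carry σ` crosses the copied squares, inserts the text of `source σ` in front of the first cell
  -- and becomes `fetch`. At `end`, `run q` creates a blank square.
  onRight : RightHead → Passive → List Letter
  onRight (carry σ) (square (copied τ)) =
    passive (square (copied τ)) ∷ rhead (carry σ) ∷ []
  onRight (carry σ) (square (cell c))   =
    lhead fetch ∷ map passive (inputs (sourceText σ) ++ [ square (cell c) ])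
  onRight (run q)   (square x)          = act (action q (content x))
  onRight (run q)   end                 =
    rhead (run q) ∷ passive (square (cell blank)) ∷ passive end ∷ []
  onRight _         _                   = [ stuck ]

  -- `fetch` looks leftwards for the next source, which it turns into a copied square. If it meets
  -- `end` instead, the text is complete and `M` starts on the square after `end`.
  onLeft : Passive → LeftHead → List Letter
  onLeft (source σ) fetch       = rhead (carry σ) ∷ passive (square (copied σ)) ∷ []
  onLeft (square x) fetch       = lhead fetch ∷ passive (square x) ∷ []
  onLeft end        fetch       = passive end ∷ rhead (run start) ∷ []
  onLeft (square x) (retreat q) = rhead (run q) ∷ passive (square x) ∷ []
  onLeft end        (retreat q) =
    passive end ∷ rhead (run q) ∷ passive (square (cell blank)) ∷ []
  onLeft (source σ) (retreat q) = [ stuck ]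

  first : Rule → Letter
  first (rotate a)  = passive a
  first (right q a) = rhead q
  first (left a q)  = passive a
  first (erase a)   = eraser
  first expand      = seed
  first finish      = eraser

  rest : Rule → List Letter
  rest (right q a) = [ passive a ]
  rest (left a q)  = [ lhead q ]
  rest (erase a)   = [ passive a ]
  rest _           = []

  output : Rule → List Letter
  output (rotate a)  = [ passive a ]
  output (right q a) = onRight q a
  output (left a q)  = onLeft a q
  output (erase a)   = [ eraser ]
  -- The text is built from right to left, so its last part is laid down first.
  output expand      = lhead fetch ∷ map passive (inputs tail ++ [ end ])
  output finish      = []

  system : QueueSystem
  system = record
    { Letter  = Letter
    ; Rule    = Rule
    ; letters = letters
    ; rules   = rules
    ; first   = first
    ; rest    = rest
    ; output  = output
    }

  open QueueSystem system using (Vanishes; empty; apply)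

  -- Steps of the queue as equivalences

  infix 4 _≈_

  _≈_ : List Letter → List Letter → Set
  w₁ ≈ w₂ = Vanishes w₁ ⇔ Vanishes w₂

  unapply : ∀ {w} → Vanishes w →
            w ≡ [] ⊎ ∃₂ λ ρ u → w ≡ first ρ ∷ rest ρ ++ u × Vanishes (u ++ output ρ)
  unapply empty           = inj₁ refl
  unapply (apply ρ {u} p) = inj₂ (ρ , u , refl , p)

  -- A left head in front of the queue is dead, so a passive letter may rotate
  -- only if no left head follows it.
  data Safe : List Letter → Set where
    []      : Safe []
    passive : ∀ {a w} → Safe (passive a ∷ w)
    rhead   : ∀ {q w} → Safe (rhead q ∷ w)
    seed    : ∀ {w} → Safe (seed ∷ w)
    eraser  : ∀ {w} → Safe (eraser ∷ w)
    stuck   : ∀ {w} → Safe (stuck ∷ w)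

  safe-∷ʳ : ∀ {w a} → Safe w → Safe (w ++ [ passive a ])
  safe-∷ʳ []      = passive
  safe-∷ʳ passive = passive
  safe-∷ʳ rhead   = rhead
  safe-∷ʳ seed    = seed
  safe-∷ʳ eraser  = eraser
  safe-∷ʳ stuck   = stuck

  safe-++ʳ : ∀ as {w} → Safe w → Safe (w ++ map passive as)
  safe-++ʳ []       {w} s = subst Safe (sym (++-identityʳ w)) s
  safe-++ʳ (a ∷ as) {w} s =
    subst Safe (++-assoc w [ passive a ] (map passive as)) (safe-++ʳ as (safe-∷ʳ s))

  safe-++ : ∀ as {w} → Safe w → Safe (map passive as ++ w)
  safe-++ []       s = s
  safe-++ (a ∷ as) s = passive

  -- Besides rotation, only a rule with a left head reads a passive letter in front, and `Safe`
  -- excludes that head.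
  rotate₁ : ∀ {a w} → Safe w → passive a ∷ w ≈ w ++ [ passive a ]
  rotate₁ {a} s = mk⇔ (to s) (apply (rotate a))
    where
    to : ∀ {w} → Safe w → Vanishes (passive a ∷ w) → Vanishes (w ++ [ passive a ])
    to s  p with unapply p
    to s  p | inj₂ (rotate _  , _ , refl , p′) = p′
    to () p | inj₂ (left _ _  , _ , refl , _)
    to s  p | inj₂ (right _ _ , _ , ()   , _)
    to s  p | inj₂ (erase _   , _ , ()   , _)
    to s  p | inj₂ (expand    , _ , ()   , _)
    to s  p | inj₂ (finish    , _ , ()   , _)

  right₁ : ∀ {q a w} → rhead q ∷ passive a ∷ w ≈ w ++ onRight q a
  right₁ {q} {a} {w} = mk⇔ to (apply (right q a))
    where
    to : Vanishes (rhead q ∷ passive a ∷ w) → Vanishes (w ++ onRight q a)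
    to p with unapply p
    ... | inj₂ (right _ _ , _ , refl , p′) = p′
    ... | inj₂ (rotate _  , _ , ()   , _)
    ... | inj₂ (left _ _  , _ , ()   , _)
    ... | inj₂ (erase _   , _ , ()   , _)
    ... | inj₂ (expand    , _ , ()   , _)
    ... | inj₂ (finish    , _ , ()   , _)

  lhead-stuck : ∀ {q w} → ¬ Vanishes (lhead q ∷ w)
  lhead-stuck p with unapply p
  ... | inj₂ (rotate _  , _ , () , _)
  ... | inj₂ (right _ _ , _ , () , _)
  ... | inj₂ (left _ _  , _ , () , _)
  ... | inj₂ (erase _   , _ , () , _)
  ... | inj₂ (expand    , _ , () , _)
  ... | inj₂ (finish    , _ , () , _)

  -- The only rival is to rotate `a`, which leaves a left head in front, where no rule applies.
  left₁ : ∀ {q a w} → passive a ∷ lhead q ∷ w ≈ w ++ onLeft a q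
  left₁ {q} {a} {w} = mk⇔ to (apply (left a q))
    where
    to : Vanishes (passive a ∷ lhead q ∷ w) → Vanishes (w ++ onLeft a q)
    to p with unapply p
    ... | inj₂ (left _ _  , _ , refl , p′) = p′
    ... | inj₂ (rotate _  , _ , refl , p′) with () ← lhead-stuck p′
    ... | inj₂ (right _ _ , _ , ()   , _)
    ... | inj₂ (erase _   , _ , ()   , _)
    ... | inj₂ (expand    , _ , ()   , _)
    ... | inj₂ (finish    , _ , ()   , _)

  expand₁ : ∀ {w} → seed ∷ w ≈ w ++ output expand
  expand₁ {w} = mk⇔ to (apply expand)
    where
    to : Vanishes (seed ∷ w) → Vanishes (w ++ output expand)
    to p with unapply p
    ... | inj₂ (expand    , _ , refl , p′) = p′
    ... | inj₂ (left _ _  , _ , ()   , _)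
    ... | inj₂ (rotate _  , _ , ()   , _)
    ... | inj₂ (right _ _ , _ , ()   , _)
    ... | inj₂ (erase _   , _ , ()   , _)
    ... | inj₂ (finish    , _ , ()   , _)

  -- No rule reads `stuck`, so each step keeps it in the queue, which then never becomes empty.
  stuck-persists : ∀ {w} → Vanishes w → ¬ stuck ∈ w
  stuck-persists (apply ρ p) stuck∈ = stuck-persists p (∈-++⁺ˡ (remains ρ stuck∈))
    where
    remains : ∀ ρ {w} → stuck ∈ first ρ ∷ rest ρ ++ w → stuck ∈ w
    remains (rotate _)  (there i)         = i
    remains (right _ _) (there (there i)) = i
    remains (left _ _)  (there (there i)) = i
    remains (erase _)   (there (there i)) = i
    remains expand      (there i)         = i
    remains finish      (there i)         = i

  ≈-setoid : Setoid _ _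
  ≈-setoid = On.setoid (⇔-setoid _) Vanishes

  open ≈-Reasoning ≈-setoid hiding (start)

  rotate* : ∀ as {w} → Safe w → map passive as ++ w ≈ w ++ map passive as
  rotate* []       {w} s = Setoid.reflexive ≈-setoid (sym (++-identityʳ w))
  rotate* (a ∷ as) {w} s = begin
    passive a ∷ map passive as ++ w        ≈⟨ rotate₁ (safe-++ as s) ⟩
    (map passive as ++ w) ++ [ passive a ] ≡⟨ ++-assoc (map passive as) w [ passive a ] ⟩
    map passive as ++ (w ++ [ passive a ]) ≈⟨ rotate* as (safe-∷ʳ s) ⟩
    (w ++ [ passive a ]) ++ map passive as ≡⟨ ++-assoc w [ passive a ] (map passive as) ⟩
    w ++ passive a ∷ map passive as        ∎

  -- Local moves of a head on the cyclic queue

  -- Queues are used as cyclic words, cut open in front of 'end'; on these the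
  -- rules act locally.
  rewrite-pair : ∀ as {w w′} bs → Safe w → Safe (map passive as ++ w′) →
                 (∀ {u} → w ++ u ≈ u ++ w′) →
                 map passive as ++ w ++ map passive bs ≈ map passive as ++ w′ ++ map passive bs
  rewrite-pair as {w} {w′} bs s s′ step = begin
    as′ ++ w ++ bs′     ≈⟨ rotate* as (safe-++ʳ bs s) ⟩
    (w ++ bs′) ++ as′   ≡⟨ ++-assoc w bs′ as′ ⟩
    w ++ (bs′ ++ as′)   ≈⟨ step ⟩
    (bs′ ++ as′) ++ w′  ≡⟨ ++-assoc bs′ as′ w′ ⟩
    bs′ ++ (as′ ++ w′)  ≈⟨ rotate* bs s′ ⟩
    (as′ ++ w′) ++ bs′  ≡⟨ ++-assoc as′ w′ bs′ ⟩
    as′ ++ w′ ++ bs′    ∎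
    where
    as′ bs′ : List Letter
    as′ = map passive as
    bs′ = map passive bs

  -- A zipper like `Tape`: `as` lists the letters between `end` and the head, nearest first.
  config : Letter → List Passive → List Passive → List Letter
  config q as bs = passive end ∷ (map passive as ʳ++ q ∷ map passive bs)

  before-head : ∀ as w → map passive (end ∷ reverse as) ++ w ≡ passive end ∷ (map passive as ʳ++ w)
  before-head as w = cong (passive end ∷_)
    (trans (cong (_++ w) (reverse-map passive as)) (sym (ʳ++-defn (map passive as))))

  right-step : ∀ {q a} as bs →
    config (rhead q) as (a ∷ bs) ≈ passive end ∷ (map passive as ʳ++ (onRight q a ++ map passive bs))
  right-step {q} {a} as bs = begin
    config (rhead q) as (a ∷ bs)
      ≡⟨ before-head as _ ⟨
    map passive (end ∷ reverse as) ++ rhead q ∷ passive a ∷ map passive bs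
      ≈⟨ rewrite-pair (end ∷ reverse as) bs rhead passive right₁ ⟩
    map passive (end ∷ reverse as) ++ onRight q a ++ map passive bs
      ≡⟨ before-head as _ ⟩
    passive end ∷ (map passive as ʳ++ (onRight q a ++ map passive bs))
      ∎

  left-step : ∀ {q a} as bs →
    config (lhead q) (a ∷ as) bs ≈ passive end ∷ (map passive as ʳ++ (onLeft a q ++ map passive bs))
  left-step {q} {a} as bs = begin
    config (lhead q) (a ∷ as) bs
      ≡⟨ before-head as _ ⟨
    map passive (end ∷ reverse as) ++ passive a ∷ lhead q ∷ map passive bs
      ≈⟨ rewrite-pair (end ∷ reverse as) bs passive passive left₁ ⟩
    map passive (end ∷ reverse as) ++ onLeft a q ++ map passive bs
      ≡⟨ before-head as _ ⟩
    passive end ∷ (map passive as ʳ++ (onLeft a q ++ map passive bs))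
      ∎

  left-end : ∀ {q} bs → config (lhead q) [] bs ≈ onLeft end q ++ map passive bs
  left-end {q} bs = rewrite-pair [] bs passive (safe q) left₁
    where
    safe : ∀ q → Safe (onLeft end q)
    safe fetch       = passive
    safe (retreat _) = passive

  -- Across the cut, the right neighbour of the head is `end`, and the rule for that pair inserts
  -- the blank before it.
  extend : ∀ {q} as → config (rhead (run q)) as [] ≈ config (rhead (run q)) as [ square (cell blank) ]
  extend {q} as = begin
    config (rhead (run q)) as []                         ≡⟨ before-head as _ ⟨
    passive end ∷ as′ ++ [ rhead (run q) ]               ≈⟨ rotate* (end ∷ reverse as) rhead ⟩
    rhead (run q) ∷ passive end ∷ as′                    ≈⟨ right₁ ⟩
    as′ ++ onRight (run q) end                           ≡⟨ ++-assoc as′ _ [ passive end ] ⟨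
    (as′ ++ rhead (run q) ∷ blank′ ∷ []) ++ [ passive end ]
      ≈⟨ rotate₁ (safe-++ (reverse as) rhead) ⟨
    passive end ∷ as′ ++ rhead (run q) ∷ blank′ ∷ []     ≡⟨ before-head as _ ⟩
    config (rhead (run q)) as [ square (cell blank) ]    ∎
    where
    as′ : List Letter
    as′ = map passive (reverse as)
    blank′ : Letter
    blank′ = passive (square (cell blank))

  -- Copying the sources and appending their texts

  carry-right : ∀ {σ} ts as bs →
    config (rhead (carry σ)) as (copies ts ++ bs) ≈ config (rhead (carry σ)) (copies ts ʳ++ as) bs
  carry-right []       as bs = Setoid.refl ≈-setoid
  carry-right (τ ∷ ts) as bs = Setoid.trans ≈-setoid (right-step as _) (carry-right ts _ bs)

  fetch-left : ∀ ts as bs →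
    config (lhead fetch) (copies ts ʳ++ as) bs ≈ config (lhead fetch) as (copies ts ++ bs)
  fetch-left []       as bs = Setoid.refl ≈-setoid
  fetch-left (τ ∷ ts) as bs = Setoid.trans ≈-setoid (fetch-left ts _ bs) (left-step as _)

  -- `carry` needs a cell on its right to detect the end of the copied squares; at `end` it would be
  -- stuck.
  deposit : ∀ {σ} as ts → ts ≢ [] →
    config (rhead (carry σ)) as (inputs ts) ≈
    config (lhead fetch) as (inputs (sourceText σ ++ ts))
  deposit as []       ts≢[] with () ← ts≢[] refl
  deposit {σ} as (τ ∷ ts) _ = begin
    config (rhead (carry σ)) as (inputs (τ ∷ ts))
      ≈⟨ right-step as (inputs ts) ⟩
    passive end ∷ (map passive as ʳ++ lhead fetch ∷ map passive new ++ map passive (inputs ts))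
      ≡⟨ cong (λ bs → passive end ∷ (map passive as ʳ++ lhead fetch ∷ bs)) (sym eq) ⟩
    config (lhead fetch) as (inputs (sourceText σ ++ τ ∷ ts))
      ∎
    where
    new : List Passive
    new = inputs (sourceText σ) ++ [ square (cell (input τ)) ]
    eq : map passive (inputs (sourceText σ ++ τ ∷ ts)) ≡
         map passive new ++ map passive (inputs ts)
    eq = trans (cong (map passive) (trans (map-++ _ (sourceText σ) (τ ∷ ts))
                                          (sym (++-assoc (inputs (sourceText σ)) _ _))))
               (map-++ passive new (inputs ts))

  tail≢[] : tail ≢ []
  tail≢[] eq with () ← ++-conicalʳ (text seed) _ eq

  -- One round of the copying loop. Its invariant: the copied squares spell `ts`, and the cells hold
  -- the texts of their sources followed by `tail`.
  copy-source : ∀ {σ} as ts →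
    config (lhead fetch) (source σ ∷ as) (copies ts ++ inputs (texts ts ++ tail)) ≈
    config (lhead fetch) as (copies (σ ∷ ts) ++ inputs (texts (σ ∷ ts) ++ tail))
  copy-source {σ} as ts = begin
    config (lhead fetch) (source σ ∷ as) (copies ts ++ inputs (texts ts ++ tail))
      ≈⟨ left-step as _ ⟩
    config (rhead (carry σ)) as (copies (σ ∷ ts) ++ inputs (texts ts ++ tail))
      ≈⟨ carry-right (σ ∷ ts) as _ ⟩
    config (rhead (carry σ)) (copies (σ ∷ ts) ʳ++ as) (inputs (texts ts ++ tail))
      ≈⟨ deposit {σ} (copies (σ ∷ ts) ʳ++ as) (texts ts ++ tail)
           (λ eq → tail≢[] (++-conicalʳ (texts ts) tail eq)) ⟩
    config (lhead fetch) (copies (σ ∷ ts) ʳ++ as)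
      (inputs (sourceText σ ++ texts ts ++ tail))
      ≈⟨ fetch-left (σ ∷ ts) as _ ⟩
    config (lhead fetch) as
      (copies (σ ∷ ts) ++ inputs (sourceText σ ++ texts ts ++ tail))
      ≡⟨ cong (λ ts′ → config (lhead fetch) as (copies (σ ∷ ts) ++ inputs ts′))
              (sym (++-assoc (sourceText σ) (texts ts) tail)) ⟩
    config (lhead fetch) as (copies (σ ∷ ts) ++ inputs (texts (σ ∷ ts) ++ tail))
      ∎

  copy-sources : ∀ ss ts →
    config (lhead fetch) (map source ss) (copies ts ++ inputs (texts ts ++ tail)) ≈
    config (lhead fetch) [] (copies (ss ʳ++ ts) ++ inputs (texts (ss ʳ++ ts) ++ tail))
  copy-sources []       ts = Setoid.refl ≈-setoid
  copy-sources (σ ∷ ss) ts =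
    Setoid.trans ≈-setoid (copy-source (map source ss) ts) (copy-sources ss (σ ∷ ts))

  seeded : List Symbol → List Letter
  seeded ts = map passive (map source ts) ++ [ seed ]

  seeded-expands : ∀ σ ts → seeded (σ ∷ ts) ≈
    config (rhead (run start)) [] (copies (σ ∷ ts) ++ inputs (texts (σ ∷ ts) ++ tail))
  seeded-expands σ ts = begin
    map passive ss ++ [ seed ]
      ≈⟨ rotate* ss seed ⟩
    seed ∷ map passive ss
      ≈⟨ expand₁ ⟩
    map passive ss ++ lhead fetch ∷ map passive (inputs tail ++ [ end ])
      ≡⟨ cong (λ w → map passive ss ++ lhead fetch ∷ w) (map-++ passive (inputs tail) [ end ]) ⟩
    map passive ss ++ (lhead fetch ∷ map passive (inputs tail)) ++ [ passive end ]
      ≡⟨ ++-assoc (map passive ss) _ _ ⟨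
    (map passive ss ++ lhead fetch ∷ map passive (inputs tail)) ++ [ passive end ]
      -- At least one source separates `end` from `fetch`, so `end` can only rotate and the step is
      -- reversible.
      ≈⟨ rotate₁ passive ⟨
    passive end ∷ map passive ss ++ lhead fetch ∷ map passive (inputs tail)
      ≡⟨ cong (λ as → map passive (end ∷ as) ++ _) (reverse-involutive ss) ⟨
    map passive (end ∷ reverse (reverse ss)) ++ lhead fetch ∷ map passive (inputs tail)
      ≡⟨ before-head (reverse ss) _ ⟩
    config (lhead fetch) (reverse ss) (inputs tail)
      ≡⟨ cong (λ as → config (lhead fetch) as (inputs tail)) (reverse-map source (σ ∷ ts)) ⟨
    config (lhead fetch) (map source (reverse (σ ∷ ts))) (inputs tail)
      ≈⟨ copy-sources (reverse (σ ∷ ts)) [] ⟩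
    config (lhead fetch) [] (result (reverse (σ ∷ ts) ʳ++ []))
      ≡⟨ cong (config (lhead fetch) [] ∘ result) (reverse-involutive (σ ∷ ts)) ⟩
    config (lhead fetch) [] (result (σ ∷ ts))
      ≈⟨ left-end _ ⟩
    config (rhead (run start)) [] (result (σ ∷ ts))
      ∎
    where
    ss : List Passive
    ss = map source (σ ∷ ts)
    result : List Symbol → List Passive
    result ts = copies ts ++ inputs (texts ts ++ tail)

  -- Running the machine inside the queue

  -- What the queue makes of the answer of `M`: it contradicts it.
  Outcome : Bool → Set → Set
  Outcome true  P = ¬ P
  Outcome false P = P

  transport : ∀ b {w w′} → w ≈ w′ → Outcome b (Vanishes w′) → Outcome b (Vanishes w)
  transport true  w≈w′ o p = o (Equivalence.to w≈w′ p)
  transport false w≈w′ p   = Equivalence.from w≈w′ p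

  erases : ∀ as → Vanishes (eraser ∷ map passive as)
  erases []       = apply finish empty
  erases (a ∷ as) = apply (erase a) (Equivalence.from (rotate* as eraser) (erases as))

  erased : ∀ as bs → Vanishes (config eraser as bs)
  erased as bs = subst Vanishes (before-head as _)
    (Equivalence.from (rotate* (end ∷ reverse as) eraser)
      (subst (Vanishes ∘ (eraser ∷_)) (map-++ passive bs (end ∷ reverse as)) (erases _)))

  halted : ∀ b {q x} as bs → action q (content x) ≡ halt b →
           Outcome b (Vanishes (config (rhead (run q)) as (square x ∷ bs)))
  halted b as bs eq = transport b (right-step as bs)
    (subst (λ α → Outcome b (Vanishes (passive end ∷ (map passive as ʳ++ act α ++ map passive bs))))
           (sym eq) (stops b))
    where
    stops : ∀ b → Outcome b (Vanishes (passive end ∷ (map passive as ʳ++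
                                         act (halt b) ++ map passive bs)))
    stops true p = stuck-persists p
      (there (subst (stuck ∈_) (sym (ʳ++-defn (map passive as)))
        (∈-++⁺ʳ (reverse (map passive as)) (here refl))))
    stops false = erased as bs

  -- Induction on the run. Squares are matched with the tape only through `content`, so copied
  -- squares serve as input cells.
  simulates : ∀ {q t b} → Halts q t b → ∀ xs ys →
              map content xs ≡ Tape.before t → map content ys ≡ Tape.head t ∷ Tape.after t →
              Outcome b (Vanishes (config (rhead (run q)) (map square xs) (map square ys)))
  simulates {b = b} (halt eq) xs (y ∷ ys) refl refl = halted b (map square xs) (map square ys) eq
  simulates {b = b} (move {q′ = q} {c = c} {d = d} eq h) xs (y ∷ ys) refl refl =
    transport b (right-step (map square xs) (map square ys))
      (subst (λ α → Outcome b (Vanishes (after-action α xs ys))) (sym eq) (moves d xs ys h))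
    where
    after-action : Action Symbol states auxiliary → List Square → List Square → List Letter
    after-action α xs ys =
      passive end ∷ (map passive (map square xs) ʳ++ act α ++ map passive (map square ys))
    moves : ∀ d xs ys → Halts q (shift d (tape (map content xs) c (map content ys))) b →
            Outcome b (Vanishes (after-action (move q c d) xs ys))
    -- At either end of the listed tape the queue inserts the blank square that `shift` supplies.
    moves left  []       ys       h =
      transport b (left-end _) (simulates h [] (cell blank ∷ cell c ∷ ys) refl refl)
    moves left  (x ∷ xs) ys       h =
      transport b (left-step (map square xs) _) (simulates h xs (x ∷ cell c ∷ ys) refl refl)
    moves right xs       []       h =
      transport b (extend (map square (cell c ∷ xs)))
        (simulates h (cell c ∷ xs) [ cell blank ] refl refl)
    moves right xs       (y ∷ ys) h = simulates h (cell c ∷ xs) (y ∷ ys) refl refl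

  seeded-outcome : ∀ σ ts {b} → Halts start (initial ((σ ∷ ts) ++ texts (σ ∷ ts) ++ tail)) b →
                   Outcome b (Vanishes (seeded (σ ∷ ts)))
  seeded-outcome σ ts {b} h = transport b (seeded-expands σ ts)
    (subst (λ bs → Outcome b (Vanishes (config (rhead (run start)) [] bs))) squares-eq
      (simulates h [] (map copied (σ ∷ ts) ++ map (cell ∘ input) rest′) refl
        (cong (input σ ∷_) content-eq)))
    where
    rest′ : List Symbol
    rest′ = texts (σ ∷ ts) ++ tail
    squares-eq : map square (map copied (σ ∷ ts) ++ map (cell ∘ input) rest′) ≡
                 copies (σ ∷ ts) ++ inputs rest′
    squares-eq = trans (map-++ square (map copied (σ ∷ ts)) _)
      (cong₂ _++_ (sym (map-∘ (σ ∷ ts))) (sym (map-∘ rest′)))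
    content-eq : map content (map copied ts ++ map (cell ∘ input) rest′) ≡ map input (ts ++ rest′)
    content-eq = trans (map-++ content (map copied ts) _)
      (trans (cong₂ _++_ (sym (map-∘ ts)) (sym (map-∘ rest′))) (sym (map-++ input ts rest′)))

-- Diagonalisation

record Reduction (K : Calculus) : Set₁ where
  open Calculus K
  open QueueSystem
  field
    sequent     : (Q : QueueSystem) → List (Letter Q) → Sequent
    oneDivision : ∀ Q w → OneDivisionFragment (sequent Q w)
    sound       : ∀ Q w → Derivable (sequent Q w) → Vanishes Q w
    complete    : ∀ Q w → Vanishes Q w → Derivable (sequent Q w)

    -- Split off so that the copied text is visibly non-empty, as the copying phase requires.
    firstSymbol : Symbol
    prefix      : QueueSystem → List Symbol
    letterText  : ℕ → List Symbol
    encoding    : ∀ Q w → encode (sequent Q w) ≡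
                  firstSymbol ∷ prefix Q ++
                  concatMap (letterText ∘ Enumeration.code (letters Q)) w ++ arrow ∷ v ∷ []

-- The system started on `w` runs `M` on the text of the sequent of `w`. If `w` vanished, the
-- sequent would be derivable, `M` would accept and `w` would not vanish. So the sequent is not
-- derivable, `M` rejects, and `w` vanishes after all.
undecidable : ∀ {K} → Reduction K → OneDivisionFragmentUndecidable K
undecidable {K} R (M , decides) = ¬vanishes (outcome (rejects (¬vanishes ∘ sound system w)))
  where
  open Calculus K
  open Reduction R
  open Simulation M letterText

  ts : List Symbol
  ts = prefix system

  -- The prefix depends on the system but not on the queue, so the queue may be chosen to spell it.
  w : List Letter
  w = seeded (firstSymbol ∷ ts)

  accepts : Derivable (sequent system w) → Run.Accepts M (encode (sequent system w))
  accepts = proj₁ (decides _ (oneDivision system w))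

  rejects : ¬ Derivable (sequent system w) → Run.Rejects M (encode (sequent system w))
  rejects = proj₂ (decides _ (oneDivision system w))

  encode-w : encode (sequent system w) ≡ (firstSymbol ∷ ts) ++ texts (firstSymbol ∷ ts) ++ tail
  encode-w = trans (encoding system w) (cong (λ s → firstSymbol ∷ ts ++ s) (begin
    concatMap text w ++ suffix
      ≡⟨ cong (_++ suffix) (concatMap-++ text (map passive (map source (firstSymbol ∷ ts))) [ seed ]) ⟩
    (concatMap text (map passive (map source (firstSymbol ∷ ts))) ++ text seed ++ []) ++ suffix
      ≡⟨ ++-assoc (concatMap text (map passive (map source (firstSymbol ∷ ts)))) _ suffix ⟩
    concatMap text (map passive (map source (firstSymbol ∷ ts))) ++ (text seed ++ []) ++ suffix
      ≡⟨ cong₂ _++_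
           (trans (concatMap-map text passive (map source (firstSymbol ∷ ts)))
                  (concatMap-map (text ∘ passive) source (firstSymbol ∷ ts)))
           (cong (_++ suffix) (++-identityʳ (text seed))) ⟩
    texts (firstSymbol ∷ ts) ++ tail
      ∎))
    where
    open ≡-Reasoning
    suffix : List Symbol
    suffix = arrow ∷ v ∷ []

  outcome : ∀ {b} → Run.Halts M (TuringMachine.start M) (Run.initial M (encode (sequent system w))) b →
            Outcome b (QueueSystem.Vanishes system w)
  outcome {b} h = seeded-outcome firstSymbol ts
    (subst (λ s → Run.Halts M (TuringMachine.start M) (Run.initial M s) b) encode-w h)

  ¬vanishes : ¬ QueueSystem.Vanishes system w
  ¬vanishes p = outcome (accepts (complete system w p)) p

-- The reductions for the five calculi

stoupFreeReduction : ∀ r → Reduction (stoupFreeCalculus r)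
stoupFreeReduction r = record
  { sequent     = λ Q → sequent Q r
  ; oneDivision = λ Q → sequent-oneDivision Q r
  ; sound       = λ Q → derivable⇒vanishes Q r
  ; complete    = λ Q w → vanishes⇒derivable Q r
  ; firstSymbol = bang
  ; prefix      = λ Q → prefix Q r
  ; letterText  = stoupFreeLetterText r
  ; encoding    = λ Q → encode-sequent Q r
  }
  where open StoupFreeReduction

stoupReduction : ∀ r {Rule : Stoup.Sequent r → Stoup.Sequent r → Set} →
                 (∀ {X} (V : ℕ → List X → Set) → StoupSoundness.Sound V r Rule) →
                 Contracts r Rule →
                 Reduction (stoupCalculus r Rule)
stoupReduction r rule-sound contract = record
  { sequent     = λ Q → sequent Q r
  ; oneDivision = λ Q → sequent-oneDivision Q r
  ; sound       = λ Q → derivable⇒vanishes Q r (rule-sound _) contract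
  ; complete    = λ Q w → vanishes⇒derivable Q r (rule-sound _) contract
  ; firstSymbol = semicolon
  ; prefix      = λ Q → prefix Q r
  ; letterText  = stoupLetterText r
  ; encoding    = λ Q → encode-sequent Q r
  }
  where open StoupReduction

theorem15 : OneDivisionFragmentUndecidable F₂₀₁₈ ×
    OneDivisionFragmentUndecidable F⁻₂₀₁₈ ×
    OneDivisionFragmentUndecidable M′₂₀₁₈ ×
    OneDivisionFragmentUndecidable M′⁻₂₀₁₈ ×
    OneDivisionFragmentUndecidable M₂₀₁₈
theorem15 =
  undecidable (stoupFreeReduction none) ,
  undecidable (stoupFreeReduction lambek) ,
  undecidable (M′-reduction none) ,
  undecidable (M′-reduction lambek) ,
  undecidable M-reduction
  where
  M-reduction : Reduction M₂₀₁₈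
  M-reduction = stoupReduction none (λ V → StoupSoundness.rule₂₀₁₈-sound V none)
    λ _ → Stoup.!C {Γ₁ = []} Stoup.∙
  M′-reduction : ∀ r → Reduction (stoupCalculus r (Stoup.Rule′₂₀₁₈ r))
  M′-reduction r = stoupReduction r (λ V → StoupSoundness.rule′₂₀₁₈-sound V r)
    λ Γ≢Λ → Stoup.!C′ {Γ₁ = []} Stoup.∙ (side r (inj₁ Γ≢Λ))
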